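{- If an interval $[U,V]\subseteq\operatorname{Bip}(\{1,2,\dots,n\})$ is not regular, then the order complex $\triangle([U,V]\setminus\{U,V\})$ is contractible. In particular, the Möbius function value $\mu(U,V)$ vanishes in $\operatorname{Bip}(\{1,2,\dots,n\})$.
   Context: A relation $U\subseteq X\times X$ on a finite set $X$ is bipartitional if both $U$ and $(X\times X)\setminus U$ are transitive. $\operatorname{Bip}(X)$ is the set of bipartitional relations on $X$, partially ordered by inclusion. The order complex $\triangle(Q)$ of a poset $Q$ is the simplicial complex whose vertices are the elements of $Q$ and whose faces are the chains of $Q$. For a bipartitional relation $U$, write $x\sim_U y$ if either both or none of $(x,y)$ and $(y,x)$ belong to $U$; this is an equivalence relation on $X$. An interval $[U,V]\subseteq\operatorname{Bip}(X)$ is called regular if every $x\in X$ satisfying $(x,x)\in V\setminus U$ also satisfies $\{y\in X: x\sim_U y\}=\{y\in X: x\sim_V y\}$. -}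

module Defs where

open import Level using (0ℓ)
import Data.Bool.Properties as Bool
open import Data.Fin.Base using (Fin; combine)
open import Data.Fin.Properties using (all?)
open import Data.Fin.Subset using (Subset; inside; outside; _∈_; _⊆_; _⊂_)
open import Data.Fin.Subset.Induction using (⊂-wellFounded)
open import Data.Fin.Subset.Properties using (_∈?_; _⊆?_; _⊂?_)
open import Data.Integer.Base as ℤ using (ℤ; 0ℤ; 1ℤ)
open import Data.List.Base using (List; []; _∷_; _++_; map; foldr)
open import Data.List.Membership.Propositional using () renaming (_∈_ to _∈ˡ_)
open import Data.List.Membership.Propositional.Properties
  using (∈-map⁺; ∈-map⁻; ∈-++⁺ˡ; ∈-++⁺ʳ)
open import Data.List.Relation.Binary.Subset.Propositional
  using () renaming (_⊆_ to _⊆ˡ_)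
open import Data.List.Relation.Binary.Subset.Propositional.Properties
  using (All-resp-⊇)
open import Data.List.Relation.Unary.All as All using (All)
open import Data.List.Relation.Unary.Any using (here)
open import Data.List.Relation.Unary.AllPairs using ([]; _∷_)
open import Data.List.Relation.Unary.Unique.Propositional using (Unique)
import Data.List.Relation.Unary.Unique.Propositional.Properties as Unique
open import Data.Nat.Base as ℕ using (ℕ; zero; suc)
import Data.Nat.Properties as ℕ
open import Data.Product.Base using (Σ-syntax; ∃-syntax; _×_; _,_)
open import Data.Rational.Base as ℚ using (ℚ; 0ℚ; 1ℚ; ½)
import Data.Rational.Properties as ℚ
open import Data.Rational.Solver using (module +-*-Solver)
open import Data.Sum.Base using (_⊎_)
open import Data.Vec.Base using ([]; _∷_)
open import Data.Vec.Properties using (≡-dec; ∷-injectiveʳ)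
open import Induction.WellFounded using (Acc; acc)
open import Relation.Binary.Core using (Rel)
open import Relation.Binary.Definitions using (Transitive; DecidableEquality)
import Relation.Binary.Definitions as B
open import Relation.Binary.PropositionalEquality
  using (_≡_; _≢_; refl; sym; trans; cong; subst)
open import Relation.Nullary.Decidable
  using (Dec; yes; no; map′; ¬?; _×-dec_; _→-dec_)
open import Relation.Nullary.Negation using (¬_)
open import Relation.Unary using (Pred; Decidable; _≐_)

------------------------------------------------------------------------
-- Real numbers: Cauchy sequences of rationals.

-- `Eventually P` : P holds for all sufficiently large indices.
Eventually : Pred ℕ 0ℓ → Set
Eventually P = ∃[ N ] (∀ k → N ℕ.≤ k → P k)

record ℝ : Set where
  field
    seq    : ℕ → ℚ
    cauchy : ∀ ε → 0ℚ ℚ.< ε →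
             ∃[ N ] (∀ j k → N ℕ.≤ j → N ℕ.≤ k → ℚ.∣ seq j ℚ.- seq k ∣ ℚ.< ε)

open ℝ public

infix 4 _≈ℝ_ _<ℝ_ _≤ℝ_
infixl 6 _+ℝ_

_≈ℝ_ : Rel ℝ 0ℓ
x ≈ℝ y = ∀ ε → 0ℚ ℚ.< ε → Eventually λ k → ℚ.∣ seq x k ℚ.- seq y k ∣ ℚ.< ε

_<ℝ_ : Rel ℝ 0ℓ
x <ℝ y = ∃[ ε ] 0ℚ ℚ.< ε × Eventually λ k → seq x k ℚ.+ ε ℚ.≤ seq y k

_≤ℝ_ : Rel ℝ 0ℓ
x ≤ℝ y = ¬ (y <ℝ x)

fromℚ : ℚ → ℝ
fromℚ q .seq _ = q
fromℚ q .cauchy ε 0<ε =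
  0 , λ _ _ _ _ → subst (ℚ._< ε) (sym (cong ℚ.∣_∣ (ℚ.+-inverseʳ q))) 0<ε

0ℝ 1ℝ : ℝ
0ℝ = fromℚ 0ℚ
1ℝ = fromℚ 1ℚ

private
  half-pos : ∀ {ε} → 0ℚ ℚ.< ε → 0ℚ ℚ.< ½ ℚ.* ε
  half-pos {ε} 0<ε = subst (ℚ._< ½ ℚ.* ε) (ℚ.*-zeroʳ ½) (ℚ.*-monoʳ-<-pos ½ 0<ε)

  half+half : ∀ ε → ½ ℚ.* ε ℚ.+ ½ ℚ.* ε ≡ ε
  half+half ε = trans (sym (ℚ.*-distribʳ-+ ε ½ ½)) (ℚ.*-identityˡ ε)

  interchange : ∀ a b c d →
    (a ℚ.+ b) ℚ.- (c ℚ.+ d) ≡ (a ℚ.- c) ℚ.+ (b ℚ.- d)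
  interchange = solve 4 (λ a b c d →
    ((a :+ b) :- (c :+ d)) := ((a :- c) :+ (b :- d))) refl
    where open +-*-Solver

_+ℝ_ : ℝ → ℝ → ℝ
(x +ℝ y) .seq k = seq x k ℚ.+ seq y k
(x +ℝ y) .cauchy ε 0<ε with cauchy x _ (half-pos 0<ε) | cauchy y _ (half-pos 0<ε)
... | M , f | N , g = M ℕ.⊔ N , λ j k j≥ k≥ → begin-strict
  ℚ.∣ (seq x j ℚ.+ seq y j) ℚ.- (seq x k ℚ.+ seq y k) ∣
    ≡⟨ cong ℚ.∣_∣ (interchange (seq x j) (seq y j) (seq x k) (seq y k)) ⟩
  ℚ.∣ (seq x j ℚ.- seq x k) ℚ.+ (seq y j ℚ.- seq y k) ∣
    ≤⟨ ℚ.∣p+q∣≤∣p∣+∣q∣ (seq x j ℚ.- seq x k) (seq y j ℚ.- seq y k) ⟩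
  ℚ.∣ seq x j ℚ.- seq x k ∣ ℚ.+ ℚ.∣ seq y j ℚ.- seq y k ∣
    <⟨ ℚ.+-mono-< (f j k (ℕ.m⊔n≤o⇒m≤o M N j≥) (ℕ.m⊔n≤o⇒m≤o M N k≥))
                  (g j k (ℕ.m⊔n≤o⇒n≤o M N j≥) (ℕ.m⊔n≤o⇒n≤o M N k≥)) ⟩
  ½ ℚ.* ε ℚ.+ ½ ℚ.* ε
    ≡⟨ half+half ε ⟩
  ε ∎
  where open ℚ.≤-Reasoning

sumℝ : List ℝ → ℝ
sumℝ = foldr _+ℝ_ 0ℝ

-- ∣ x − y ∣ < ε
Within : ℚ → Rel ℝ 0ℓ
Within ε x y = x <ℝ y +ℝ fromℚ ε × y <ℝ x +ℝ fromℚ ε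

-- The unit interval [0,1].
record 𝕀 : Set where
  field
    value : ℝ
    0≤    : 0ℝ ≤ℝ value
    ≤1    : value ≤ℝ 1ℝ

open 𝕀 public

private
  ≤⇒≤ℝ : ∀ {p q} → p ℚ.≤ q → fromℚ p ≤ℝ fromℚ q
  ≤⇒≤ℝ {p} {q} p≤q (ε , 0<ε , N , f) =
    ℚ.<-irrefl refl (ℚ.<-≤-trans q<q+ε (ℚ.≤-trans (f N ℕ.≤-refl) p≤q))
    where
    q<q+ε : q ℚ.< q ℚ.+ ε
    q<q+ε = subst (ℚ._< q ℚ.+ ε) (ℚ.+-identityʳ q) (ℚ.+-monoʳ-< q 0<ε)

0𝕀 1𝕀 : 𝕀
0𝕀 = record { value = 0ℝ ; 0≤ = ≤⇒≤ℝ ℚ.≤-refl ; ≤1 = ≤⇒≤ℝ (ℚ.nonNegative⁻¹ 1ℚ) }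
1𝕀 = record { value = 1ℝ ; 0≤ = ≤⇒≤ℝ (ℚ.nonNegative⁻¹ 1ℚ) ; ≤1 = ≤⇒≤ℝ ℚ.≤-refl }

------------------------------------------------------------------------
-- Finite simplicial complexes and contractibility

-- A finite simplicial complex whose vertices lie in the finite type
-- `Label`.  A list stands for the set of its entries; the vertices of the
-- complex are the labels v for which `v ∷ []` is a face.
record SimplicialComplex : Set₁ where
  field
    Label    : Set
    labels   : List Label
    complete : ∀ v → v ∈ˡ labels
    unique   : Unique labels
    Face     : Pred (List Label) 0ℓ
    face-⊆   : ∀ {σ τ} → σ ⊆ˡ τ → Face τ → Face σ

-- A point of the geometric realisation, in barycentric coordinates.
-- `support` says that { v ∣ coord v > 0 } is a face; it is phrased through
-- the finite subsets of the support, since positivity of a real number is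
-- not decidable.  In particular coord vanishes at labels that are not
-- vertices.
record ∥_∥ (K : SimplicialComplex) : Set where
  open SimplicialComplex K
  field
    coord   : Label → ℝ
    nonneg  : ∀ v → 0ℝ ≤ℝ coord v
    total   : sumℝ (map coord labels) ≈ℝ 1ℝ
    support : ∀ σ → All (λ v → 0ℝ <ℝ coord v) σ → Face σ

open ∥_∥ public

_≈∥_ : ∀ {K} → Rel ∥ K ∥ 0ℓ
p ≈∥ q = ∀ v → coord p v ≈ℝ coord q v

-- Continuity of a map ∥ K ∥ × [0,1] → ∥ K ∥, where ∥ K ∥ carries the
-- subspace topology of the finite power ℝ^Label.  It implies that H respects
-- equality of points and of parameters.
Continuous : ∀ {K} → (∥ K ∥ → 𝕀 → ∥ K ∥) → Set
Continuous H = ∀ p s ε → 0ℚ ℚ.< ε →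
  ∃[ δ ] 0ℚ ℚ.< δ ×
    (∀ q t → (∀ v → Within δ (coord p v) (coord q v)) →
             Within δ (value s) (value t) →
             ∀ v → Within ε (coord (H p s) v) (coord (H q t) v))

-- The identity of the realisation is homotopic to a constant map.
Contractible : SimplicialComplex → Set
Contractible K =
  Σ[ c ∈ ∥ K ∥ ] Σ[ H ∈ (∥ K ∥ → 𝕀 → ∥ K ∥) ]
    Continuous H × (∀ p → H p 0𝕀 ≈∥ p) × (∀ p → H p 1𝕀 ≈∥ c)

------------------------------------------------------------------------
-- Posets of subsets, ordered by inclusion

subsets : ∀ m → List (Subset m)
subsets zero    = [] ∷ []
subsets (suc m) = map (outside ∷_) (subsets m) ++ map (inside ∷_) (subsets m)

subsets-complete : ∀ {m} (W : Subset m) → W ∈ˡ subsets m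
subsets-complete []                      = here refl
subsets-complete (outside ∷ W)           =
  ∈-++⁺ˡ (∈-map⁺ (outside ∷_) (subsets-complete W))
subsets-complete {suc m} (inside ∷ W)    =
  ∈-++⁺ʳ (map (outside ∷_) (subsets m)) (∈-map⁺ (inside ∷_) (subsets-complete W))

subsets-unique : ∀ m → Unique (subsets m)
subsets-unique zero    = All.[] ∷ []
subsets-unique (suc m) = Unique.++⁺
  (Unique.map⁺ ∷-injectiveʳ (subsets-unique m))
  (Unique.map⁺ ∷-injectiveʳ (subsets-unique m))
  λ (∈₁ , ∈₂) → distinct (∈-map⁻ _ ∈₁) (∈-map⁻ _ ∈₂)
  where
  distinct : ∀ {W : Subset (suc m)} →
    ∃[ A ] (A ∈ˡ subsets m × W ≡ outside ∷ A) →
    ¬ (∃[ B ] (B ∈ˡ subsets m × W ≡ inside ∷ B))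
  distinct (_ , _ , refl) (_ , _ , ())

-- The order complex of the family Q of subsets.
△ : ∀ {m} → Pred (Subset m) 0ℓ → SimplicialComplex
△ {m} Q = record
  { Label    = Subset m
  ; labels   = subsets m
  ; complete = subsets-complete
  ; unique   = subsets-unique m
  ; Face     = λ σ → All Q σ × (∀ {A B} → A ∈ˡ σ → B ∈ˡ σ → A ⊆ B ⊎ B ⊆ A)
  ; face-⊆   = λ σ⊆τ (inQ , chain) →
      All-resp-⊇ σ⊆τ inQ , λ A∈σ B∈σ → chain (σ⊆τ A∈σ) (σ⊆τ B∈σ)
  }

_≟ˢ_ : ∀ {m} → DecidableEquality (Subset m)
_≟ˢ_ = ≡-dec Bool._≟_

-- The Möbius function of the family Q:
--   μ(U,U) = 1,   μ(U,V) = − Σ { μ(U,W) ∣ W ∈ Q, U ⊆ W ⊂ V }  for U ≠ V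
-- (so μ(U,V) = 0 unless U ⊆ V).
module _ {m} {Q : Pred (Subset m) 0ℓ} (Q? : Decidable Q) (U : Subset m) where

  möbiusAcc : ∀ V → Acc _⊂_ V → ℤ
  möbiusAcc V (acc rs) with U ≟ˢ V
  ... | yes _ = 1ℤ
  ... | no  _ = ℤ.- foldr ℤ._+_ 0ℤ (map term (subsets m))
    where
    term : Subset m → ℤ
    term W with Q? W | U ⊆? W | W ⊂? V
    ... | yes _ | yes _ | yes W⊂V = möbiusAcc W (rs W⊂V)
    ... | _     | _     | _       = 0ℤ

  möbius : Subset m → ℤ
  möbius V = möbiusAcc V (⊂-wellFounded V)

------------------------------------------------------------------------
-- Bipartitional relations

-- Relations on Fin n, i.e. subsets of Fin n × Fin n ≅ Fin (n * n).
Relation : ℕ → Set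
Relation n = Subset (n ℕ.* n)

module _ (n : ℕ) where

  Holds : Relation n → Rel (Fin n) 0ℓ
  Holds U x y = combine x y ∈ U

  Bip : Pred (Relation n) 0ℓ
  Bip U = Transitive (Holds U) × Transitive (λ x y → ¬ Holds U x y)

  private
    transitive? : {R : Rel (Fin n) 0ℓ} → B.Decidable R → Dec (Transitive R)
    transitive? R? = map′ (λ f {x} {y} {z} → f x y z) (λ f x y z → f)
      (all? λ x → all? λ y → all? λ z → R? x y →-dec (R? y z →-dec R? x z))

  Bip? : Decidable Bip
  Bip? U = transitive? (λ x y → combine x y ∈? U)
     ×-dec transitive? (λ x y → ¬? (combine x y ∈? U))

  Equiv : Relation n → Rel (Fin n) 0ℓ
  Equiv U x y = (Holds U x y × Holds U y x) ⊎ (¬ Holds U x y × ¬ Holds U y x)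

  Interval : Relation n → Relation n → Pred (Relation n) 0ℓ
  Interval U V W = Bip W × U ⊆ W × W ⊆ V

  ProperPart : Relation n → Relation n → Pred (Relation n) 0ℓ
  ProperPart U V W = Interval U V W × W ≢ U × W ≢ V

  Regular : Relation n → Relation n → Set
  Regular U V = ∀ x → Holds V x x → ¬ Holds U x x → Equiv U x ≐ Equiv V x

{-# OPTIONS --safe #-}

-- Let x violate regularity and let y lie in exactly one of the blocks of x in U
-- and in V.  Up to transposition and complementation, y lies in the block of x in
-- U and strictly precedes the block of x in V.  Split the block of x in U into the
-- part A strictly preceding x in V and the remaining part B.  Then g W, the join of
-- W with U ∪ A × B, is a closure operator on [U,V].  It never takes the value U, and
-- since g W and W relate x to the same elements, g W = V only for W = V.  Hence
-- W ⊆ g W ⊇ g U contracts the proper part of [U,V].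
--
-- On the order complex, W ↦ g W is realised without any subdivision by moving the
-- mass of a point along g gradually, elements higher in the chain first, so that
-- the labels carrying mass form a chain at every time; afterwards all mass moves
-- to g U.  The Möbius function vanishes by Weisner's argument for g.
module Submission where

open import Defs
open import Level using (0ℓ)
open import Algebra.Core using (Op₂)
open import Algebra.Structures using (IsCommutativeMonoid)
open import Data.Bool.Base using (true)
open import Data.Fin.Base using (Fin; combine; remQuot)
open import Data.Fin.Properties using (any?; combine-remQuot; remQuot-combine)
open import Data.Fin.Subset using (Subset; _∈_; _⊆_; _⊂_)
open import Data.Fin.Subset.Induction using (⊂-wellFounded)
open import Data.Fin.Subset.Properties
  using (_∈?_; _⊆?_; _⊂?_; ⊆-refl; ⊆-reflexive; ⊆-trans; ⊆-antisym; ⊆-isPartialOrder)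
open import Data.Integer.Base as ℤ using (ℤ; 0ℤ; 1ℤ)
import Data.Integer.Properties as ℤ
open import Data.List.Base using (List; []; _∷_; map; foldr)
open import Data.List.Properties using (map-cong)
open import Data.List.Membership.Propositional using () renaming (_∈_ to _∈ˡ_)
open import Data.List.Relation.Unary.All as All using (All)
open import Data.List.Relation.Unary.AllPairs using (_∷_)
open import Data.List.Relation.Unary.Any using (here; there)
open import Data.List.Relation.Unary.Unique.Propositional using (Unique)
open import Data.Nat.Base as ℕ using (ℕ)
import Data.Nat.Properties as ℕ
open import Data.Product.Base using (∃-syntax; _×_; _,_; proj₁; proj₂; uncurry)
open import Data.Rational.Base
  using (ℚ; 0ℚ; 1ℚ; ½; _+_; _-_; -_; _*_; _⊓_; _⊔_; _<_; _≤_; ∣_∣)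
import Data.Rational.Properties as ℚ
open import Data.Rational.Solver using (module +-*-Solver)
open import Data.Sum.Base using (_⊎_; inj₁; inj₂; swap; [_,_]′)
open import Data.Unit.Base using (tt)
open import Data.Vec.Base using (lookup; tabulate)
open import Data.Vec.Properties using (lookup⇒[]=; []=⇒lookup; lookup∘tabulate)
open import Function.Base using (_∘_; _$_; const; flip)
open import Induction.WellFounded using (Acc; acc)
open import Relation.Binary.Core using (Rel)
import Relation.Binary.Construct.Flip.EqAndOrd as Flip
import Relation.Binary.Definitions as B
open import Relation.Binary.Definitions using (DecidableEquality; Transitive)
open import Relation.Binary.PropositionalEquality
open import Relation.Binary.Structures using (IsPartialOrder)
open import Relation.Nullary.Decidable
  using (Dec; yes; no; does; ¬?; _×-dec_; _⊎-dec_; decidable-stable; dec-true)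
open import Relation.Nullary.Negation using (¬_; contradiction)
open import Relation.Unary using (Pred; Decidable)

-- Finite sums

module FiniteSum {C : Set} {_∙_ : Op₂ C} {ε : C}
                 (isCM : IsCommutativeMonoid _≡_ _∙_ ε) where

  open IsCommutativeMonoid isCM using (assoc; comm; identityˡ; identityʳ)

  private variable A B : Set

  sum : (A → C) → List A → C
  sum f xs = foldr _∙_ ε (map f xs)

  -- Sums are restricted by replacing terms with `ε` rather than by filtering, so that all of them
  -- run over one list and can be compared termwise.
  when : {P : Set} → Dec P → C → C
  when (yes _) c = c
  when (no _)  c = ε

  when-yes : ∀ {P} (P? : Dec P) {c} → P → when P? c ≡ c
  when-yes (yes _) p = refl
  when-yes (no ¬p) p = contradiction p ¬p

  when-no : ∀ {P} (P? : Dec P) {c} → ¬ P → when P? c ≡ ε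
  when-no (yes p) ¬p = contradiction p ¬p
  when-no (no _)  ¬p = refl

  when-⇔ : ∀ {P R} (P? : Dec P) (R? : Dec R) {c} → (P → R) → (R → P) → when P? c ≡ when R? c
  when-⇔ (yes p) R? P⇒R R⇒P = sym (when-yes R? (P⇒R p))
  when-⇔ (no ¬p) R? P⇒R R⇒P = sym (when-no R? (¬p ∘ R⇒P))

  when-ε : ∀ {P} (P? : Dec P) {c} → (P → c ≡ ε) → when P? c ≡ ε
  when-ε (yes p) eq = eq p
  when-ε (no _)  eq = refl

  sum-cong : ∀ {f g : A → C} xs → (∀ x → f x ≡ g x) → sum f xs ≡ sum g xs
  sum-cong xs eq = cong (foldr _∙_ ε) (map-cong eq xs)

  sum-ε : ∀ {f : A → C} xs → (∀ x → f x ≡ ε) → sum f xs ≡ ε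
  sum-ε []       eq = refl
  sum-ε (x ∷ xs) eq = trans (cong₂ _∙_ (eq x) (sum-ε xs eq)) (identityˡ ε)

  sum-∙ : ∀ (f g : A → C) xs → sum (λ x → f x ∙ g x) xs ≡ sum f xs ∙ sum g xs
  sum-∙ f g []       = sym (identityˡ ε)
  sum-∙ f g (x ∷ xs) = begin
    (f x ∙ g x) ∙ sum (λ y → f y ∙ g y) xs
      ≡⟨ cong ((f x ∙ g x) ∙_) (sum-∙ f g xs) ⟩
    (f x ∙ g x) ∙ (sum f xs ∙ sum g xs)
      ≡⟨ assoc _ _ _ ⟩
    f x ∙ (g x ∙ (sum f xs ∙ sum g xs))
      ≡⟨ cong (f x ∙_) (trans (sym (assoc _ _ _))
           (trans (cong (_∙ sum g xs) (comm _ _)) (assoc _ _ _))) ⟩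
    f x ∙ (sum f xs ∙ (g x ∙ sum g xs))
      ≡⟨ assoc _ _ _ ⟨
    (f x ∙ sum f xs) ∙ (g x ∙ sum g xs) ∎
    where open ≡-Reasoning

  sum-swap : ∀ (f : A → B → C) xs ys →
    sum (λ x → sum (f x) ys) xs ≡ sum (λ y → sum (λ x → f x y) xs) ys
  sum-swap f []       ys = sym (sum-ε ys λ _ → refl)
  sum-swap f (x ∷ xs) ys = trans (cong (sum (f x) ys ∙_) (sum-swap f xs ys))
    (sym (sum-∙ (f x) (λ y → sum (λ x′ → f x′ y) xs) ys))

  sum-point : ∀ (_≟_ : DecidableEquality A) {xs a} (h : A → C) → Unique xs → a ∈ˡ xs →
    sum (λ x → when (a ≟ x) (h x)) xs ≡ h a
  sum-point _≟_ {x ∷ xs} h (x∉ ∷ u) (here refl) = trans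
    (cong₂ _∙_ (when-yes (x ≟ x) refl) (others xs x∉)) (identityʳ _)
    where
    others : ∀ ys → All (x ≢_) ys → sum (λ y → when (x ≟ y) (h y)) ys ≡ ε
    others []       All.[]       = refl
    others (y ∷ ys) (x≢y All.∷ p) =
      trans (cong₂ _∙_ (when-no (x ≟ y) x≢y) (others ys p)) (identityˡ ε)
  sum-point _≟_ {x ∷ xs} {a} h (x∉ ∷ u) (there a∈) = trans
    (cong₂ _∙_ (when-no (a ≟ x) λ { refl → All.lookup x∉ a∈ refl })
               (sum-point _≟_ h u a∈))
    (identityˡ _)

  -- After the order of summation is exchanged, each `y` leaves a sum over `xs` whose only term is
  -- at `x = f y`; it occurs once because `xs` lists every value exactly once.
  sum-fibres : ∀ (_≟_ : DecidableEquality A) {xs} (f : B → A) (h : A → B → C) ys →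
    Unique xs → (∀ a → a ∈ˡ xs) →
    sum (λ x → sum (λ y → when (f y ≟ x) (h x y)) ys) xs ≡ sum (λ y → h (f y) y) ys
  sum-fibres _≟_ {xs} f h ys u c = trans
    (sum-swap (λ x y → when (f y ≟ x) (h x y)) xs ys)
    (sum-cong ys λ y → sum-point _≟_ (λ x → h x y) u (c (f y)))

⊆∧⊉⇒⊂ : ∀ {m} {S T : Subset m} → S ⊆ T → ¬ T ⊆ S → S ⊂ T
⊆∧⊉⇒⊂ {S = S} {T} S⊆T T⊈S with any? (λ x → (x ∈? T) ×-dec ¬? (x ∈? S))
... | yes w = S⊆T , w
... | no ¬w = contradiction
  (λ {x} x∈T → decidable-stable (x ∈? S) λ x∉S → ¬w (x , x∈T , x∉S)) T⊈S

⊂⇒⊉ : ∀ {m} {S T : Subset m} → S ⊂ T → ¬ T ⊆ S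
⊂⇒⊉ (_ , x , x∈T , x∉S) T⊆S = x∉S (T⊆S x∈T)

-- The Möbius function

module _ {m} {Q : Pred (Subset m) 0ℓ} (Q? : Decidable Q) (U : Subset m) where

  open FiniteSum ℤ.+-0-isCommutativeMonoid

  private
    μ : Subset m → ℤ
    μ = möbius Q? U

  -- Collects the conditions of the recursion other than `W ⊂ V`, since the sums below differ only
  -- in what stands in place of that condition.
  supported : (Subset m → ℤ) → Subset m → ℤ
  supported f W = when (Q? W ×-dec U ⊆? W) (f W)

  private mutual
    -- The summand in the definition of `möbiusAcc` has no accessible name: the
    -- type of `term-≡` is inferred from its use in `möbiusAcc-unfold`.
    möbiusAcc-unfold : ∀ V (a : ∀ {W} → W ⊂ V → Acc _⊂_ W) (f : Subset m → ℤ) →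
      (∀ {W} (W⊂V : W ⊂ V) → möbiusAcc Q? U W (a W⊂V) ≡ f W) → U ≢ V →
      möbiusAcc Q? U V (acc a) ≡
      ℤ.- sum (λ W → when (W ⊂? V) (supported f W)) (subsets m)
    möbiusAcc-unfold V a f eq U≢V with U ≟ˢ V
    ... | yes U≡V = contradiction U≡V U≢V
    ... | no U≢V′ = cong ℤ.-_ (cong (foldr ℤ._+_ 0ℤ)
                      (map-cong (λ W → term-≡ V a f eq U≢V′ W) (subsets m)))

    term-≡ : ∀ V (a : ∀ {W} → W ⊂ V → Acc _⊂_ W) (f : Subset m → ℤ)
      (eq : ∀ {W} (W⊂V : W ⊂ V) → möbiusAcc Q? U W (a W⊂V) ≡ f W) (U≢V : U ≢ V) W →
      _ ≡ when (W ⊂? V) (supported f W)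
    term-≡ V a f eq U≢V W with Q? W | U ⊆? W | W ⊂? V
    ... | yes _ | yes _ | yes W⊂V = eq W⊂V
    ... | yes _ | yes _ | no  _   = refl
    ... | yes _ | no  _ | yes _   = refl
    ... | yes _ | no  _ | no  _   = refl
    ... | no  _ | yes _ | yes _   = refl
    ... | no  _ | yes _ | no  _   = refl
    ... | no  _ | no  _ | yes _   = refl
    ... | no  _ | no  _ | no  _   = refl

  private
    möbiusAcc-diagonal : ∀ {V} (a : Acc _⊂_ V) → U ≡ V → möbiusAcc Q? U V a ≡ 1ℤ
    möbiusAcc-diagonal {V} (acc _) U≡V with U ≟ˢ V
    ... | yes _  = refl
    ... | no U≢V = contradiction U≡V U≢V

    -- The induction runs on a third accessibility proof, because `go` takes apart both of the
    -- proofs under comparison.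
    möbiusAcc-irrelevant : ∀ {V} → Acc _⊂_ V → (a : Acc _⊂_ V) → möbiusAcc Q? U V a ≡ μ V
    möbiusAcc-irrelevant {V} (acc ih) a = go a (⊂-wellFounded V) (U ≟ˢ V)
      where
      go : (a a′ : Acc _⊂_ V) → Dec (U ≡ V) → möbiusAcc Q? U V a ≡ möbiusAcc Q? U V a′
      go a       a′       (yes U≡V) =
        trans (möbiusAcc-diagonal a U≡V) (sym (möbiusAcc-diagonal a′ U≡V))
      go (acc a) (acc a′) (no U≢V)  = trans
        (möbiusAcc-unfold V a μ (λ W⊂V → möbiusAcc-irrelevant (ih W⊂V) (a W⊂V)) U≢V)
        (sym (möbiusAcc-unfold V a′ μ (λ W⊂V → möbiusAcc-irrelevant (ih W⊂V) (a′ W⊂V)) U≢V))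

  möbius-unfold : ∀ {V} → U ≢ V →
    μ V ≡ ℤ.- sum (λ W → when (W ⊂? V) (supported μ W)) (subsets m)
  möbius-unfold {V} U≢V = go (⊂-wellFounded V)
    where
    go : ∀ a → möbiusAcc Q? U V a ≡
      ℤ.- sum (λ W → when (W ⊂? V) (supported μ W)) (subsets m)
    go (acc a) = möbiusAcc-unfold V a μ
      (λ {W} W⊂V → möbiusAcc-irrelevant (⊂-wellFounded W) (a W⊂V)) U≢V

  supported-∈ : ∀ f {W} → Q W → U ⊆ W → supported f W ≡ f W
  supported-∈ f {W} q U⊆W = when-yes (Q? W ×-dec U ⊆? W) (q , U⊆W)

  -- By the recursion, the term at `V` is the negative of the sum of all the others.
  sum-möbius : ∀ {V} → Q V → U ⊆ V → U ≢ V →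
    sum (λ W → when (W ⊆? V) (supported μ W)) (subsets m) ≡ 0ℤ
  sum-möbius {V} q U⊆V U≢V = begin
    sum (λ W → when (W ⊆? V) (supported μ W)) (subsets m)
      ≡⟨ sum-cong (subsets m) split ⟩
    sum (λ W → when (W ⊂? V) (supported μ W) ℤ.+ when (V ≟ˢ W) (supported μ W)) (subsets m)
      ≡⟨ sum-∙ _ _ (subsets m) ⟩
    s ℤ.+ sum (λ W → when (V ≟ˢ W) (supported μ W)) (subsets m)
      ≡⟨ cong (λ z → s ℤ.+ z) (sum-point _≟ˢ_ _ (subsets-unique m) (subsets-complete V)) ⟩
    s ℤ.+ supported μ V
      ≡⟨ cong (λ z → s ℤ.+ z) (trans (supported-∈ μ q U⊆V) (möbius-unfold U≢V)) ⟩
    s ℤ.+ ℤ.- s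
      ≡⟨ ℤ.+-inverseʳ s ⟩
    0ℤ ∎
    where
    open ≡-Reasoning
    s = sum (λ W → when (W ⊂? V) (supported μ W)) (subsets m)
    split : ∀ W → when (W ⊆? V) (supported μ W) ≡
                  when (W ⊂? V) (supported μ W) ℤ.+ when (V ≟ˢ W) (supported μ W)
    split W = by-cases (V ⊆? W)
      where
      by-cases : Dec (V ⊆ W) → _
      by-cases (no V⊈W) = sym (trans
        (cong₂ ℤ._+_ (when-⇔ (W ⊂? V) (W ⊆? V) proj₁ (λ W⊆V → ⊆∧⊉⇒⊂ W⊆V V⊈W))
                     (when-no (V ≟ˢ W) λ { refl → V⊈W ⊆-refl }))
        (ℤ.+-identityʳ _))
      by-cases (yes V⊆W) = sym (trans
        (cong₂ ℤ._+_ (when-no (W ⊂? V) λ W⊂V → ⊂⇒⊉ W⊂V V⊆W)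
                     (when-⇔ (V ≟ˢ W) (W ⊆? V) (λ { refl → ⊆-refl }) (⊆-antisym V⊆W)))
        (ℤ.+-identityˡ _))

  module _ {V : Subset m} (g : Subset m → Subset m) where

    private
      Within[U,V] : Pred (Subset m) 0ℓ
      Within[U,V] W = Q W × U ⊆ W × W ⊆ V

    -- By induction μ U vanishes at every W that is not fixed by g: the only terms
    -- left in the sum over T ⊂ W are those with T ⊆ g W, and these cancel.
    möbius-interior : Within[U,V] V →
      (∀ {W} → Within[U,V] W → Within[U,V] (g W)) →
      (∀ {W} → g W ⊆ W) →
      (∀ {S T} → S ⊆ T → g S ⊆ g T) →
      (∀ {W} → Within[U,V] W → W ≢ U → g W ≢ U) →
      ¬ V ⊆ g V → μ V ≡ 0ℤ
    möbius-interior V∈ g-∈ g⊆ g-mono g≢U = vanish V∈ (⊂-wellFounded V)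
      where
      vanish : ∀ {W} → Within[U,V] W → Acc _⊂_ W → ¬ W ⊆ g W → μ W ≡ 0ℤ
      vanish {W} W∈@(_ , U⊆W , W⊆V) (acc ih) W⊈gW = begin
        μ W
          ≡⟨ möbius-unfold (W≢U ∘ sym) ⟩
        ℤ.- sum (λ T → when (T ⊂? W) (supported μ T)) (subsets m)
          ≡⟨ cong ℤ.-_ (sum-cong (subsets m) below) ⟩
        ℤ.- sum (λ T → when (T ⊆? g W) (supported μ T)) (subsets m)
          ≡⟨ cong ℤ.-_ (sum-möbius (proj₁ (g-∈ W∈)) (proj₁ (proj₂ (g-∈ W∈))) (g≢U W∈ W≢U ∘ sym)) ⟩
        0ℤ ∎
        where
        open ≡-Reasoning
        W≢U : W ≢ U
        W≢U refl = W⊈gW (proj₁ (proj₂ (g-∈ W∈)))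
        below : ∀ T → when (T ⊂? W) (supported μ T) ≡ when (T ⊆? g W) (supported μ T)
        below T with T ⊆? g W
        ... | yes T⊆gW = when-yes (T ⊂? W)
          (⊆∧⊉⇒⊂ (⊆-trans T⊆gW g⊆) λ W⊆T → W⊈gW (⊆-trans W⊆T T⊆gW))
        -- Such a `T` is not fixed by `g`, since `T ⊆ g T` would give `T ⊆ g W` by monotonicity; the
        -- induction hypothesis removes it.
        ... | no T⊈gW = when-ε (T ⊂? W) λ T⊂W → when-ε (Q? T ×-dec U ⊆? T) λ (q , U⊆T) →
          vanish (q , U⊆T , ⊆-trans (proj₁ T⊂W) W⊆V) (ih T⊂W)
            λ T⊆gT → T⊈gW (⊆-trans T⊆gT (g-mono (proj₁ T⊂W)))

    -- As in Weisner's theorem, the sum of μ U over each fibre of g vanishes, and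
    -- the fibre over V is {V}.
    möbius-closure : Within[U,V] V →
      (∀ {W} → Within[U,V] W → Within[U,V] (g W)) →
      (∀ {W} → W ⊆ g W) →
      (∀ {S T} → S ⊆ T → g S ⊆ g T) →
      (∀ {W} → Within[U,V] W → g (g W) ⊆ g W) →
      (∀ {W} → Within[U,V] W → g W ≢ U) →
      (∀ {W} → Within[U,V] W → W ≢ V → g W ≢ V) →
      μ V ≡ 0ℤ
    möbius-closure V∈@(qV , U⊆V , _) g-∈ ⊆g g-mono g-idem g≢U g≢V = begin
      μ V
        ≡⟨ supported-∈ μ qV U⊆V ⟨
      supported μ V
        ≡⟨ sum-point _≟ˢ_ _ (subsets-unique m) (subsets-complete V) ⟨
      sum (λ T → when (V ≟ˢ T) (supported μ T)) (subsets m)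
        ≡⟨ sum-cong (subsets m) fibre-V ⟩
      fibre V
        ≡⟨ vanish V∈ gV⊆V (⊂-wellFounded V) ⟩
      0ℤ ∎
      where
      open ≡-Reasoning
      fibre : Subset m → ℤ
      fibre K = sum (λ T → when (g T ≟ˢ K) (supported μ T)) (subsets m)

      gV⊆V : g V ⊆ V
      gV⊆V = proj₂ (proj₂ (g-∈ V∈))

      fibre-V : ∀ T → when (V ≟ˢ T) (supported μ T) ≡ when (g T ≟ˢ V) (supported μ T)
      fibre-V T with V ≟ˢ T
      ... | yes refl = sym (when-yes (g V ≟ˢ V) (⊆-antisym gV⊆V ⊆g))
      ... | no V≢T   = sym (when-ε (g T ≟ˢ V) λ gT≡V → when-ε (Q? T ×-dec U ⊆? T) λ (q , U⊆T) →
        contradiction gT≡V (g≢V (q , U⊆T , subst (T ⊆_) gT≡V ⊆g) (V≢T ∘ sym)))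

      -- For closed `K`, `T ⊆ K` holds exactly when `g T ⊆ K`. So the vanishing sum over `T ⊆ K` is
      -- the sum of the fibres over all `K′ ⊆ K`, and those over `K′ ⊂ K` vanish by induction.
      vanish : ∀ {K} → Within[U,V] K → g K ⊆ K → Acc _⊂_ K → fibre K ≡ 0ℤ
      vanish {K} K∈@(qK , U⊆K , K⊆V) gK⊆K (acc ih) = begin
        fibre K
          ≡⟨ ℤ.+-identityʳ _ ⟨
        fibre K ℤ.+ 0ℤ
          ≡⟨ cong (λ z → fibre K ℤ.+ z) smaller ⟨
        fibre K ℤ.+ sum (λ T → when (g T ⊂? K) (supported μ T)) (subsets m)
          ≡⟨ sum-∙ _ _ (subsets m) ⟨
        sum (λ T → when (g T ≟ˢ K) (supported μ T) ℤ.+ when (g T ⊂? K) (supported μ T)) (subsets m)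
          ≡⟨ sum-cong (subsets m) split ⟨
        sum (λ T → when (T ⊆? K) (supported μ T)) (subsets m)
          ≡⟨ sum-möbius qK U⊆K (U≢K ∘ sym) ⟩
        0ℤ ∎
        where
        U≢K : K ≢ U
        U≢K K≡U = g≢U K∈ (trans (⊆-antisym gK⊆K ⊆g) K≡U)

        smaller-fibre : ∀ K′ → K′ ⊂ K → fibre K′ ≡ 0ℤ
        smaller-fibre K′ K′⊂K = by-cases (Q? K′ ×-dec (U ⊆? K′ ×-dec g K′ ⊆? K′))
          where
          K′⊆V = ⊆-trans (proj₁ K′⊂K) K⊆V
          by-cases : Dec (Q K′ × U ⊆ K′ × g K′ ⊆ K′) → fibre K′ ≡ 0ℤ
          by-cases (yes (q , U⊆K′ , closed)) = vanish (q , U⊆K′ , K′⊆V) closed (ih K′⊂K)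
          -- `g` maps the interval to closed elements of the interval, so the fibre over any other
          -- `K′` contains no supported `T`.
          by-cases (no ¬K′) = sum-ε (subsets m) λ T →
            when-ε (g T ≟ˢ K′) λ { refl → when-no (Q? T ×-dec U ⊆? T) λ (q , U⊆T) →
              let T∈ : Within[U,V] T
                  T∈ = q , U⊆T , ⊆-trans ⊆g K′⊆V
              in ¬K′ (proj₁ (g-∈ T∈) , proj₁ (proj₂ (g-∈ T∈)) , g-idem T∈) }

        smaller : sum (λ T → when (g T ⊂? K) (supported μ T)) (subsets m) ≡ 0ℤ
        smaller = begin
          sum (λ T → when (g T ⊂? K) (supported μ T)) (subsets m)
            ≡⟨ sum-fibres _≟ˢ_ g (λ K′ T → when (K′ ⊂? K) (supported μ T)) (subsets m)
                 (subsets-unique m) subsets-complete ⟨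
          sum (λ K′ → sum (λ T → when (g T ≟ˢ K′) (when (K′ ⊂? K) (supported μ T)))
                          (subsets m))
              (subsets m)
            ≡⟨ sum-ε (subsets m) (λ K′ → inner K′ (K′ ⊂? K)) ⟩
          0ℤ ∎
          where
          inner : ∀ K′ (d : Dec (K′ ⊂ K)) →
            sum (λ T → when (g T ≟ˢ K′) (when d (supported μ T))) (subsets m) ≡ 0ℤ
          inner K′ (yes K′⊂K) = smaller-fibre K′ K′⊂K
          inner K′ (no _)     = sum-ε (subsets m) λ T → when-ε (g T ≟ˢ K′) λ _ → refl

        split : ∀ T → when (T ⊆? K) (supported μ T) ≡
          when (g T ≟ˢ K) (supported μ T) ℤ.+ when (g T ⊂? K) (supported μ T)
        split T = by-cases (K ⊆? g T)
          where
          T⊆K⇒gT⊆K : T ⊆ K → g T ⊆ K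
          T⊆K⇒gT⊆K T⊆K = ⊆-trans (g-mono T⊆K) gK⊆K
          by-cases : Dec (K ⊆ g T) → _
          by-cases (yes K⊆gT) = sym (trans
            (cong₂ ℤ._+_
              (when-⇔ (g T ≟ˢ K) (T ⊆? K) (λ { refl → ⊆g }) (λ T⊆K → ⊆-antisym (T⊆K⇒gT⊆K T⊆K) K⊆gT))
              (when-no (g T ⊂? K) λ gT⊂K → ⊂⇒⊉ gT⊂K K⊆gT))
            (ℤ.+-identityʳ _))
          by-cases (no K⊈gT) = sym (trans
            (cong₂ ℤ._+_
              (when-no (g T ≟ˢ K) λ { refl → K⊈gT ⊆-refl })
              (when-⇔ (g T ⊂? K) (T ⊆? K) (λ gT⊂K → ⊆-trans ⊆g (proj₁ gT⊂K))
                (λ T⊆K → ⊆∧⊉⇒⊂ (T⊆K⇒gT⊆K T⊆K) K⊈gT)))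
            (ℤ.+-identityˡ _))

-- Rational approximation

half-pos : ∀ {ε} → 0ℚ < ε → 0ℚ < ½ * ε
half-pos {ε} 0<ε = subst (_< ½ * ε) (ℚ.*-zeroʳ ½) (ℚ.*-monoʳ-<-pos ½ 0<ε)

half+half : ∀ ε → ½ * ε + ½ * ε ≡ ε
half+half ε = trans (sym (ℚ.*-distribʳ-+ ε ½ ½)) (ℚ.*-identityˡ ε)

-- Here `e` is added to a known inequality; the two equations, often supplied by the ring solver,
-- bring its ends into the wanted form.
<-shift : ∀ e {a b c d} → a < b → a + e ≡ c → b + e ≡ d → c < d
<-shift e a<b refl refl = ℚ.+-monoˡ-< e a<b

≤-shift : ∀ e {a b c d} → a ≤ b → a + e ≡ c → b + e ≡ d → c ≤ d
≤-shift e a≤b refl refl = ℚ.+-monoˡ-≤ e a≤b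

x<x+ε : ∀ x {ε} → 0ℚ < ε → x < x + ε
x<x+ε x {ε} 0<ε = subst (_< x + ε) (ℚ.+-identityʳ x) (ℚ.+-monoʳ-< x 0<ε)

x≤x+y : ∀ x {y} → 0ℚ ≤ y → x ≤ x + y
x≤x+y x {y} 0≤y = subst (_≤ x + y) (ℚ.+-identityʳ x) (ℚ.+-monoʳ-≤ x 0≤y)

y≤x+y : ∀ {x} y → 0ℚ ≤ x → y ≤ x + y
y≤x+y {x} y 0≤x = subst (_≤ x + y) (ℚ.+-identityˡ y) (ℚ.+-monoˡ-≤ y 0≤x)

x+y-y : ∀ x y → x + y - y ≡ x
x+y-y = solve 2 (λ x y → x :+ y :- y := x) refl
  where open +-*-Solver

x-y+y : ∀ x y → x - y + y ≡ x
x-y+y = solve 2 (λ x y → x :- y :+ y := x) refl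
  where open +-*-Solver

+-nonneg : ∀ {x y} → 0ℚ ≤ x → 0ℚ ≤ y → 0ℚ ≤ x + y
+-nonneg = ℚ.+-mono-≤

⊓-pos : ∀ {x y} → 0ℚ < x → 0ℚ < y → 0ℚ < x ⊓ y
⊓-pos {x} {y} 0<x 0<y with ℚ.⊓-sel x y
... | inj₁ eq = subst (0ℚ <_) (sym eq) 0<x
... | inj₂ eq = subst (0ℚ <_) (sym eq) 0<y

infix 4 _≈[_]_

-- A record rather than a product, so that x and y can be inferred from it.
record _≈[_]_ (x ε y : ℚ) : Set where
  constructor _,_
  field
    ≈⇒< : x < y + ε
    ≈⇒> : y < x + ε

open _≈[_]_

≈-refl : ∀ {ε x} → 0ℚ < ε → x ≈[ ε ] x
≈-refl 0<ε = x<x+ε _ 0<ε , x<x+ε _ 0<ε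

≈-weaken : ∀ {ε δ x y} → ε ≤ δ → x ≈[ ε ] y → x ≈[ δ ] y
≈-weaken {x = x} {y} ε≤δ (x<y , y<x) =
  ℚ.<-≤-trans x<y (ℚ.+-monoʳ-≤ y ε≤δ) , ℚ.<-≤-trans y<x (ℚ.+-monoʳ-≤ x ε≤δ)

≈-+ : ∀ {ε x y u v} → x ≈[ ½ * ε ] y → u ≈[ ½ * ε ] v → x + u ≈[ ε ] y + v
≈-+ {ε} {x} {y} {u} {v} (x<y , y<x) (u<v , v<u) = add x y u v x<y u<v , add y x v u y<x v<u
  where
  open +-*-Solver
  add : ∀ x y u v → x < y + ½ * ε → u < v + ½ * ε → x + u < y + v + ε
  add x y u v p q = subst (x + u <_)
    (trans (solve 3 (λ y v h → (y :+ h) :+ (v :+ h) := (y :+ v) :+ (h :+ h)) refl y v (½ * ε))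
           (cong (y + v +_) (half+half ε)))
    (ℚ.+-mono-< p q)

≈-neg : ∀ {ε x y} → x ≈[ ε ] y → - x ≈[ ε ] - y
≈-neg {ε} {x} {y} (x<y , y<x) = negate x y y<x , negate y x x<y
  where
  open +-*-Solver
  negate : ∀ x y → y < x + ε → - x < - y + ε
  negate x y p = <-shift (- x - y) p
    (solve 2 (λ x y → y :+ (:- x :- y) := :- x) refl x y)
    (solve 3 (λ x y ε → x :+ ε :+ (:- x :- y) := :- y :+ ε) refl x y ε)

≈-− : ∀ {ε x y u v} → x ≈[ ½ * ε ] y → u ≈[ ½ * ε ] v → x - u ≈[ ε ] y - v
≈-− p q = ≈-+ p (≈-neg q)

-- Adding the hypotheses puts `x + y` near `y + z`, and translation by `- y` preserves closeness.
≈-trans : ∀ {ε x y z} → x ≈[ ½ * ε ] y → y ≈[ ½ * ε ] z → x ≈[ ε ] z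
≈-trans {ε} {x} {y} {z} p q = subst₂ (_≈[ ε ]_)
  (solve 2 (λ x y → x :+ y :- y := x) refl x y)
  (solve 2 (λ y z → y :+ z :- y := z) refl y z)
  (shift (≈-+ p q))
  where
  open +-*-Solver
  shift : x + y ≈[ ε ] y + z → x + y - y ≈[ ε ] y + z - y
  shift (p , q) = <-shift (- y) p refl
      (solve 3 (λ y z ε → y :+ z :+ ε :- y := y :+ z :- y :+ ε) refl y z ε) ,
    <-shift (- y) q refl
      (solve 3 (λ x y ε → x :+ y :+ ε :- y := x :+ y :- y :+ ε) refl x y ε)

≈-⊓ : ∀ {ε x y u v} → x ≈[ ε ] y → u ≈[ ε ] v → x ⊓ u ≈[ ε ] y ⊓ v
≈-⊓ {ε} {x} {y} {u} {v} (x<y , y<x) (u<v , v<u) = bound x y u v x<y u<v , bound y x v u y<x v<u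
  where
  bound : ∀ x y u v → x < y + ε → u < v + ε → x ⊓ u < y ⊓ v + ε
  bound x y u v p q with ℚ.⊓-sel y v
  ... | inj₁ eq = subst (λ z → x ⊓ u < z + ε) (sym eq) (ℚ.≤-<-trans (ℚ.p⊓q≤p x u) p)
  ... | inj₂ eq = subst (λ z → x ⊓ u < z + ε) (sym eq) (ℚ.≤-<-trans (ℚ.p⊓q≤q x u) q)

≈-⊔ : ∀ {ε x y u v} → x ≈[ ε ] y → u ≈[ ε ] v → x ⊔ u ≈[ ε ] y ⊔ v
≈-⊔ {ε} {x} {y} {u} {v} (x<y , y<x) (u<v , v<u) = bound x y u v x<y u<v , bound y x v u y<x v<u
  where
  bound : ∀ x y u v → x < y + ε → u < v + ε → x ⊔ u < y ⊔ v + ε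
  bound x y u v p q with ℚ.⊔-sel x u
  ... | inj₁ eq = subst (_< y ⊔ v + ε) (sym eq) (ℚ.<-≤-trans p (ℚ.+-monoˡ-≤ ε (ℚ.p≤p⊔q y v)))
  ... | inj₂ eq = subst (_< y ⊔ v + ε) (sym eq) (ℚ.<-≤-trans q (ℚ.+-monoˡ-≤ ε (ℚ.p≤q⊔p y v)))

p≤∣p∣ : ∀ p → p ≤ ∣ p ∣
p≤∣p∣ p with ℚ.∣p∣≡p∨∣p∣≡-p p
... | inj₁ eq = ℚ.≤-reflexive (sym eq)
... | inj₂ eq = ℚ.≤-trans
  (≤-shift p (subst (0ℚ ≤_) eq (ℚ.0≤∣p∣ p)) (ℚ.+-identityˡ p) (ℚ.+-inverseˡ p)) (ℚ.0≤∣p∣ p)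

∣-∣<⇒≈ : ∀ {ε} x y → ∣ x - y ∣ < ε → x ≈[ ε ] y
∣-∣<⇒≈ {ε} x y d = bound x y d , bound y x (subst (_< ε) sym-dist d)
  where
  open +-*-Solver
  bound : ∀ x y → ∣ x - y ∣ < ε → x < y + ε
  bound x y d = <-shift y (ℚ.≤-<-trans (p≤∣p∣ (x - y)) d) (x-y+y x y) (ℚ.+-comm ε y)
  sym-dist : ∣ x - y ∣ ≡ ∣ y - x ∣
  sym-dist = trans (sym (ℚ.∣-p∣≡∣p∣ (x - y)))
    (cong ∣_∣ (solve 2 (λ x y → :- (x :- y) := y :- x) refl x y))

≈⇒∣-∣< : ∀ {ε} x y → x ≈[ ε ] y → ∣ x - y ∣ < ε
≈⇒∣-∣< {ε} x y (x<y , y<x) with ℚ.∣p∣≡p∨∣p∣≡-p (x - y)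
... | inj₁ eq = subst (_< ε) (sym eq) (<-shift (- y) x<y refl
  (solve 2 (λ y ε → y :+ ε :- y := ε) refl y ε))
  where open +-*-Solver
... | inj₂ eq = subst (_< ε) (sym eq) (<-shift (- x) y<x
  (solve 2 (λ x y → y :- x := :- (x :- y)) refl x y)
  (solve 2 (λ x ε → x :+ ε :- x := ε) refl x ε))
  where open +-*-Solver

open FiniteSum ℚ.+-0-isCommutativeMonoid

when-≈ : ∀ {P : Set} (P? : Dec P) {ε x y} → 0ℚ < ε → x ≈[ ε ] y →
  when P? x ≈[ ε ] when P? y
when-≈ (yes _) 0<ε p = p
when-≈ (no _)  0<ε p = ≈-refl 0<ε

when-nonneg : ∀ {P : Set} (P? : Dec P) {x} → 0ℚ ≤ x → 0ℚ ≤ when P? x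
when-nonneg (yes _) 0≤x = 0≤x
when-nonneg (no _)  0≤x = ℚ.≤-refl

when-positive : ∀ {P : Set} (P? : Dec P) {x δ} → 0ℚ < δ → δ ≤ when P? x → P × δ ≤ x
when-positive (yes p) 0<δ δ≤ = p , δ≤
when-positive (no _)  0<δ δ≤ = contradiction (ℚ.<-≤-trans 0<δ δ≤) (ℚ.<-irrefl refl)

module _ {A : Set} where

  sum-mono-≤ : ∀ {f h : A → ℚ} xs → (∀ x → f x ≤ h x) → sum f xs ≤ sum h xs
  sum-mono-≤ []       f≤h = ℚ.≤-refl
  sum-mono-≤ (x ∷ xs) f≤h = ℚ.+-mono-≤ (f≤h x) (sum-mono-≤ xs f≤h)

  sum-nonneg : ∀ {f : A → ℚ} xs → (∀ x → 0ℚ ≤ f x) → 0ℚ ≤ sum f xs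
  sum-nonneg []       0≤f = ℚ.≤-refl
  sum-nonneg (x ∷ xs) 0≤f = +-nonneg (0≤f x) (sum-nonneg xs 0≤f)

  term≤sum : ∀ {f : A → ℚ} {x xs} → (∀ x → 0ℚ ≤ f x) → x ∈ˡ xs → f x ≤ sum f xs
  term≤sum {f} {x} {_ ∷ xs} 0≤f (here refl) = x≤x+y (f x) (sum-nonneg xs 0≤f)
  term≤sum {f} {x} {y ∷ xs} 0≤f (there x∈) =
    ℚ.≤-trans (term≤sum 0≤f x∈) (y≤x+y (sum f xs) (0≤f y))

  -- Abstract here and below because normalising the rational arithmetic in these
  -- moduli, as a with-abstraction does, is infeasible.
  abstract
    sum-≈ : ∀ (xs : List A) ε → 0ℚ < ε → ∃[ δ ] 0ℚ < δ ×
      (∀ {f h : A → ℚ} → (∀ x → f x ≈[ δ ] h x) → sum f xs ≈[ ε ] sum h xs)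
    sum-≈ []       ε 0<ε = ε , 0<ε , λ _ → ≈-refl 0<ε
    sum-≈ (x ∷ xs) ε 0<ε with sum-≈ xs (½ * ε) (half-pos 0<ε)
    ... | δ , 0<δ , close = δ ⊓ (½ * ε) , ⊓-pos 0<δ (half-pos 0<ε) , λ p →
      ≈-+ (≈-weaken (ℚ.p⊓q≤q δ (½ * ε)) (p x))
          (close (λ y → ≈-weaken (ℚ.p⊓q≤p δ (½ * ε)) (p y)))

    -- Either the head is at least half of `ε` or the rest of the sum is. The bound `δ` does not
    -- depend on `f`, so one `δ` serves all approximations of a point.
    sum-positive : ∀ (xs : List A) ε → 0ℚ < ε → ∃[ δ ] 0ℚ < δ ×
      (∀ {f : A → ℚ} → ε ≤ sum f xs → ∃[ x ] δ ≤ f x)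
    sum-positive []       ε 0<ε = ε , 0<ε , λ ε≤0 →
      contradiction (ℚ.<-≤-trans 0<ε ε≤0) (ℚ.<-irrefl refl)
    sum-positive (x ∷ xs) ε 0<ε with sum-positive xs (½ * ε) (half-pos 0<ε)
    ... | δ , 0<δ , find = δ ⊓ (½ * ε) , ⊓-pos 0<δ (half-pos 0<ε) , locate
      where
      locate : ∀ {f : A → ℚ} → ε ≤ f x + sum f xs → ∃[ y ] δ ⊓ (½ * ε) ≤ f y
      locate {f} ε≤ with ½ * ε ℚ.≤? f x
      ... | yes p = x , ℚ.≤-trans (ℚ.p⊓q≤q δ (½ * ε)) p
      ... | no ¬p with find {f} (ℚ.≮⇒≥ λ q → ℚ.<-irrefl refl (ℚ.≤-<-trans ε≤
                        (subst (f x + sum f xs <_) (half+half ε) (ℚ.+-mono-< (ℚ.≰⇒> ¬p) q))))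
      ...   | y , r = y , ℚ.≤-trans (ℚ.p⊓q≤p δ (½ * ε)) r

-- Moving mass along a map

module Transport {m : ℕ} where

  mass : (Subset m → ℚ) → ℚ
  mass q = sum q (subsets m)

  -- An amount q W ⊓ r W of the mass at W is moved to f W.
  move : (Subset m → Subset m) → (r q : Subset m → ℚ) → Subset m → ℚ
  move f r q v = (q v - q v ⊓ r v) + mass (λ W → when (f W ≟ˢ v) (q W ⊓ r W))

  private
    sum-along : ∀ (f : Subset m → Subset m) (h : Subset m → ℚ) →
      mass (λ v → mass (λ W → when (f W ≟ˢ v) (h W))) ≡ mass h
    sum-along f h = sum-fibres _≟ˢ_ f (λ _ → h) (subsets m) (subsets-unique m) subsets-complete

    ⊓-nonneg : ∀ {x y} → 0ℚ ≤ x → 0ℚ ≤ y → 0ℚ ≤ x ⊓ y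
    ⊓-nonneg = ℚ.⊓-glb

    x-x⊓y-nonneg : ∀ x y → 0ℚ ≤ x - x ⊓ y
    x-x⊓y-nonneg x y = ≤-shift (- (x ⊓ y)) (ℚ.p⊓q≤p x y) (ℚ.+-inverseʳ (x ⊓ y)) refl

    δ≤x-x⊓y : ∀ {δ} x y → 0ℚ < δ → δ ≤ x - x ⊓ y → y + δ ≤ x
    δ≤x-x⊓y {δ} x y 0<δ δ≤ with ℚ.⊓-sel x y
    ... | inj₁ eq = contradiction
      (ℚ.<-≤-trans 0<δ (subst (δ ≤_) (trans (cong (λ z → x - z) eq) (ℚ.+-inverseʳ x)) δ≤))
      (ℚ.<-irrefl refl)
    ... | inj₂ eq = ≤-shift y (subst (λ z → δ ≤ x - z) eq δ≤) (ℚ.+-comm δ y) (x-y+y x y)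

  move-nonneg : ∀ f {r q : Subset m → ℚ} → (∀ W → 0ℚ ≤ r W) → (∀ W → 0ℚ ≤ q W) →
    ∀ v → 0ℚ ≤ move f r q v
  move-nonneg f {r} {q} 0≤r 0≤q v = +-nonneg (x-x⊓y-nonneg (q v) (r v))
    (sum-nonneg (subsets m) λ W → when-nonneg (f W ≟ˢ v) (⊓-nonneg (0≤q W) (0≤r W)))

  -- Summed over all targets, the arrivals amount to what has left, as every `W` has exactly one
  -- target `f W`.
  move-mass : ∀ f (r q : Subset m → ℚ) → mass (move f r q) ≡ mass q
  move-mass f r q = begin
    mass (move f r q)
      ≡⟨ sum-∙ (λ v → q v - q v ⊓ r v) _ (subsets m) ⟩
    mass (λ v → q v - q v ⊓ r v) + mass (λ v → mass (λ W → when (f W ≟ˢ v) (q W ⊓ r W)))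
      ≡⟨ cong (mass (λ v → q v - q v ⊓ r v) +_) (sum-along f (λ W → q W ⊓ r W)) ⟩
    mass (λ v → q v - q v ⊓ r v) + mass (λ W → q W ⊓ r W)
      ≡⟨ sum-∙ (λ v → q v - q v ⊓ r v) (λ W → q W ⊓ r W) (subsets m) ⟨
    mass (λ v → q v - q v ⊓ r v + q v ⊓ r v)
      ≡⟨ sum-cong (subsets m) (λ v → x-y+y (q v) (q v ⊓ r v)) ⟩
    mass q ∎
    where open ≡-Reasoning

  move-none : ∀ f (r q : Subset m → ℚ) → (∀ W → q W ⊓ r W ≡ 0ℚ) → ∀ v → move f r q v ≡ q v
  move-none f r q none v = begin
    (q v - q v ⊓ r v) + mass (λ W → when (f W ≟ˢ v) (q W ⊓ r W))
      ≡⟨ cong₂ (λ x y → (q v - x) + y) (none v)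
               (sum-ε (subsets m) (λ W → when-ε (f W ≟ˢ v) λ _ → none W)) ⟩
    (q v - 0ℚ) + 0ℚ
      ≡⟨ trans (ℚ.+-identityʳ _) (ℚ.+-identityʳ _) ⟩
    q v ∎
    where open ≡-Reasoning

  move-all : ∀ f (r q : Subset m → ℚ) → (∀ W → q W ≤ r W) →
    ∀ v → move f r q v ≡ mass (λ W → when (f W ≟ˢ v) (q W))
  move-all f r q q≤r v = begin
    (q v - q v ⊓ r v) + mass (λ W → when (f W ≟ˢ v) (q W ⊓ r W))
      ≡⟨ cong₂ (λ x y → (q v - x) + y) (ℚ.p≤q⇒p⊓q≡p (q≤r v))
           (sum-cong (subsets m) λ W → cong (when (f W ≟ˢ v)) (ℚ.p≤q⇒p⊓q≡p (q≤r W))) ⟩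
    (q v - q v) + mass (λ W → when (f W ≟ˢ v) (q W))
      ≡⟨ cong (_+ mass (λ W → when (f W ≟ˢ v) (q W))) (ℚ.+-inverseʳ (q v)) ⟩
    0ℚ + mass (λ W → when (f W ≟ˢ v) (q W))
      ≡⟨ ℚ.+-identityˡ _ ⟩
    mass (λ W → when (f W ≟ˢ v) (q W)) ∎
    where open ≡-Reasoning

  move-≈ : ∀ f ε → 0ℚ < ε → ∃[ δ ] 0ℚ < δ × (∀ {r r′ q q′ : Subset m → ℚ} →
    (∀ W → r W ≈[ δ ] r′ W) → (∀ W → q W ≈[ δ ] q′ W) →
    ∀ v → move f r q v ≈[ ε ] move f r′ q′ v)
  move-≈ f ε 0<ε with sum-≈ (subsets m) (½ * ε) (half-pos 0<ε)
  ... | δ₁ , 0<δ₁ , sum-close = δ , ⊓-pos 0<δ₁ 0<δ₂ , λ r≈ q≈ v →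
    ≈-+ (≈-− (≈-weaken δ≤δ₂ (q≈ v)) (≈-weaken δ≤δ₂ (≈-⊓ (q≈ v) (r≈ v))))
        (sum-close λ W → when-≈ (f W ≟ˢ v) 0<δ₁ (≈-weaken δ≤δ₁ (≈-⊓ (q≈ W) (r≈ W))))
    where
    δ₂ = ½ * (½ * ε)
    δ = δ₁ ⊓ δ₂
    0<δ₂ = half-pos (half-pos 0<ε)
    δ≤δ₁ = ℚ.p⊓q≤p δ₁ δ₂
    δ≤δ₂ = ℚ.p⊓q≤q δ₁ δ₂

  abstract
    -- One summand of `move` is at least half of `ε`. If it is the remainder at `v`, the minimum
    -- there must be `r v`, for otherwise nothing would remain; if it is the arrivals, one of them
    -- is bounded below.
    move-positive : ∀ f ε → 0ℚ < ε → ∃[ δ ] 0ℚ < δ × (∀ {r q : Subset m → ℚ} v → ε ≤ move f r q v →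
      r v + δ ≤ q v ⊎ ∃[ W ] f W ≡ v × δ ≤ q W × δ ≤ r W)
    move-positive f ε 0<ε with sum-positive (subsets m) (½ * ε) (half-pos 0<ε)
    ... | δ₁ , 0<δ₁ , find = δ₁ ⊓ (½ * ε) , ⊓-pos 0<δ₁ (half-pos 0<ε) , locate
      where
      locate : ∀ {r q : Subset m → ℚ} v → ε ≤ move f r q v →
        r v + δ₁ ⊓ (½ * ε) ≤ q v ⊎ ∃[ W ] f W ≡ v × δ₁ ⊓ (½ * ε) ≤ q W × δ₁ ⊓ (½ * ε) ≤ r W
      locate {r} {q} v ε≤ with ½ * ε ℚ.≤? q v - q v ⊓ r v
      ... | yes p = inj₁ (ℚ.≤-trans (ℚ.+-monoʳ-≤ (r v) (ℚ.p⊓q≤q δ₁ (½ * ε)))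
                            (δ≤x-x⊓y (q v) (r v) (half-pos 0<ε) p))
      ... | no ¬p with find {λ W → when (f W ≟ˢ v) (q W ⊓ r W)}
                         (ℚ.≮⇒≥ λ s → ℚ.<-irrefl refl (ℚ.≤-<-trans ε≤
                           (subst (move f r q v <_) (half+half ε) (ℚ.+-mono-< (ℚ.≰⇒> ¬p) s))))
      ...   | W , δ≤ with when-positive (f W ≟ˢ v) 0<δ₁ δ≤
      ...     | fW≡v , δ≤⊓ = inj₂ (W , fW≡v ,
                  ℚ.≤-trans (ℚ.≤-trans (ℚ.p⊓q≤p δ₁ (½ * ε)) δ≤⊓) (ℚ.p⊓q≤p (q W) (r W)) ,
                  ℚ.≤-trans (ℚ.≤-trans (ℚ.p⊓q≤p δ₁ (½ * ε)) δ≤⊓) (ℚ.p⊓q≤q (q W) (r W)))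

-- The two-stage deformation on rational coordinates

module Contraction {m : ℕ} {_⊑_ : Rel (Subset m) 0ℓ} (isPO : IsPartialOrder _≡_ _⊑_)
  (_⊑?_ : B.Decidable _⊑_) (g : Subset m → Subset m) (c : Subset m) where

  open Transport
  private module ⊑ = IsPartialOrder isPO

  infix 4 _⊏_ _⊏?_

  _⊏_ : Rel (Subset m) 0ℓ
  W ⊏ T = W ⊑ T × W ≢ T

  _⊏?_ : B.Decidable _⊏_
  W ⊏? T = (W ⊑? T) ×-dec ¬? (W ≟ˢ T)

  above : (Subset m → ℚ) → Subset m → ℚ
  above q W = mass (λ T → when (W ⊏? T) (q T))

  -- In the first stage `W` moves between the times `above q W` and `above q W + q W`. With `P` the
  -- elements strictly above some `W′ ⊏ W`, the bound says that `W` finishes before `W′` begins;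
  -- with `P` always true, that `W` finishes before the second stage begins.
  above-≤ : ∀ {P : Pred (Subset m) 0ℓ} (P? : Decidable P) {q : Subset m → ℚ} →
    (∀ W → 0ℚ ≤ q W) → ∀ {W} → P W → (∀ {T} → W ⊏ T → P T) →
    above q W + q W ≤ mass (λ T → when (P? T) (q T))
  above-≤ P? {q} 0≤q {W} PW P-⊏ = begin
    above q W + q W
      ≡⟨ cong (above q W +_) (sum-point _≟ˢ_ q (subsets-unique m) (subsets-complete W)) ⟨
    above q W + mass (λ T → when (W ≟ˢ T) (q T))
      ≡⟨ sum-∙ (λ T → when (W ⊏? T) (q T)) (λ T → when (W ≟ˢ T) (q T)) (subsets m) ⟨
    mass (λ T → when (W ⊏? T) (q T) + when (W ≟ˢ T) (q T))
      ≤⟨ sum-mono-≤ (subsets m) (λ T → termwise T (W ≟ˢ T)) ⟩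
    mass (λ T → when (P? T) (q T)) ∎
    where
    open ℚ.≤-Reasoning
    termwise : ∀ T (d : Dec (W ≡ T)) → when (W ⊏? T) (q T) + when d (q T) ≤ when (P? T) (q T)
    termwise T (yes refl) = ℚ.≤-reflexive (trans
      (cong (_+ q W) (when-no (W ⊏? W) λ (_ , W≢W) → W≢W refl))
      (trans (ℚ.+-identityˡ (q W)) (sym (when-yes (P? W) PW))))
    termwise T (no W≢T) = subst (_≤ when (P? T) (q T)) (sym (ℚ.+-identityʳ _)) (lemma (W ⊏? T))
      where
      lemma : ∀ (d : Dec (W ⊏ T)) → when d (q T) ≤ when (P? T) (q T)
      lemma (yes W⊏T) = ℚ.≤-reflexive (sym (when-yes (P? T) (P-⊏ W⊏T)))
      lemma (no _)    = when-nonneg (P? T) (0≤q T)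

  -- The rational approximations of a nonnegative real may be negative.
  clamp : (Subset m → ℚ) → Subset m → ℚ
  clamp a v = a v ⊔ 0ℚ

  -- The mass of the approximations is only close to 1.  At s = 1 the time is 4, which
  -- exceeds twice that mass, so the second stage is over.
  time : ℚ → ℚ
  time s = ((s ⊔ 0ℚ) + (s ⊔ 0ℚ)) + ((s ⊔ 0ℚ) + (s ⊔ 0ℚ))

  -- In the first stage W waits until all mass above it has moved; the second stage
  -- waits until all mass has.
  rate₁ rate₂ : (Subset m → ℚ) → ℚ → Subset m → ℚ
  rate₁ a s W = (time s - above (clamp a) W) ⊔ 0ℚ
  rate₂ a s _ = (time s - mass (clamp a)) ⊔ 0ℚ

  stage₁ stage₂ : (Subset m → ℚ) → ℚ → Subset m → ℚ
  stage₁ a s = move g (rate₁ a s) (clamp a)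
  stage₂ a s = move (const c) (rate₂ a s) (stage₁ a s)

  clamp-nonneg : ∀ a v → 0ℚ ≤ clamp a v
  clamp-nonneg a v = ℚ.p≤q⊔p (a v) 0ℚ

  stage₁-nonneg : ∀ a s v → 0ℚ ≤ stage₁ a s v
  stage₁-nonneg a s =
    move-nonneg g (λ W → ℚ.p≤q⊔p (time s - above (clamp a) W) 0ℚ) (clamp-nonneg a)

  stage₂-nonneg : ∀ a s v → 0ℚ ≤ stage₂ a s v
  stage₂-nonneg a s =
    move-nonneg (const c) (λ _ → ℚ.p≤q⊔p (time s - mass (clamp a)) 0ℚ) (stage₁-nonneg a s)

  stage₁-mass : ∀ a s → mass (stage₁ a s) ≡ mass (clamp a)
  stage₁-mass a s = move-mass g (rate₁ a s) (clamp a)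

  stage₂-mass : ∀ a s → mass (stage₂ a s) ≡ mass (clamp a)
  stage₂-mass a s = trans (move-mass (const c) (rate₂ a s) (stage₁ a s)) (stage₁-mass a s)

  private
    -x⊔0≡0 : ∀ {x} → 0ℚ ≤ x → (0ℚ - x) ⊔ 0ℚ ≡ 0ℚ
    -x⊔0≡0 {x} 0≤x = ℚ.p≤q⇒p⊔q≡q
      (≤-shift (- x) 0≤x refl (ℚ.+-inverseʳ x))

    ⊓0≡0 : ∀ {x y} → 0ℚ ≤ x → y ≡ 0ℚ → x ⊓ y ≡ 0ℚ
    ⊓0≡0 0≤x refl = ℚ.p≥q⇒p⊓q≡q 0≤x

  stage₂-start : ∀ a v → stage₂ a 0ℚ v ≡ clamp a v
  stage₂-start a v = trans
    (move-none (const c) (rate₂ a 0ℚ) (stage₁ a 0ℚ) (λ W → ⊓0≡0 (stage₁-nonneg a 0ℚ W)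
      (-x⊔0≡0 (sum-nonneg (subsets m) (clamp-nonneg a)))) v)
    (move-none g (rate₁ a 0ℚ) (clamp a) (λ W → ⊓0≡0 (clamp-nonneg a W)
      (-x⊔0≡0 (sum-nonneg (subsets m) λ T → when-nonneg (W ⊏? T) (clamp-nonneg a T)))) v)

  -- Late approximations satisfy the bound, as their mass tends to 1. Since `time 1ℚ` computes to 4,
  -- the second rate is then at least the whole mass, enough to empty every label.
  stage₂-end : ∀ a → mass (clamp a) ≤ 1ℚ + 1ℚ → ∀ v →
    stage₂ a 1ℚ v ≡ when (c ≟ˢ v) (mass (clamp a))
  stage₂-end a T≤2 v = trans
    (move-all (const c) (rate₂ a 1ℚ) (stage₁ a 1ℚ) moved v)
    (trans (sum-when (c ≟ˢ v) (stage₁ a 1ℚ)) (cong (when (c ≟ˢ v)) (stage₁-mass a 1ℚ)))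
    where
    open ℚ.≤-Reasoning
    T = mass (clamp a)
    moved : ∀ W → stage₁ a 1ℚ W ≤ (time 1ℚ - T) ⊔ 0ℚ
    moved W = begin
      stage₁ a 1ℚ W        ≤⟨ term≤sum (stage₁-nonneg a 1ℚ) (subsets-complete W) ⟩
      mass (stage₁ a 1ℚ)   ≡⟨ stage₁-mass a 1ℚ ⟩
      T                    ≤⟨ ≤-shift (- T) (ℚ.+-mono-≤ T≤2 T≤2) (x+y-y T T) refl ⟩
      time 1ℚ - T          ≤⟨ ℚ.p≤p⊔q _ 0ℚ ⟩
      (time 1ℚ - T) ⊔ 0ℚ   ∎
    sum-when : ∀ {P : Set} (P? : Dec P) (q : Subset m → ℚ) →
      mass (λ W → when P? (q W)) ≡ when P? (mass q)
    sum-when (yes _) q = refl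
    sum-when (no _)  q = sum-ε (subsets m) λ _ → refl

  private
    time-≈ : ∀ {ε s t} → 0ℚ < ε → s ≈[ ½ * (½ * ε) ] t → time s ≈[ ε ] time t
    time-≈ 0<ε s≈t = ≈-+ (≈-+ s⊔0≈ s⊔0≈) (≈-+ s⊔0≈ s⊔0≈)
      where s⊔0≈ = ≈-⊔ s≈t (≈-refl (half-pos (half-pos 0<ε)))

  -- As `δ` depends on `ε` alone, the estimate yields both the Cauchy property of the moving
  -- coordinates and the continuity of the homotopy.
  stage₂-≈ : ∀ ε → 0ℚ < ε → ∃[ δ ] 0ℚ < δ × (∀ {a b s t} →
    (∀ W → a W ≈[ δ ] b W) → s ≈[ δ ] t → ∀ v → stage₂ a s v ≈[ ε ] stage₂ b t v)
  stage₂-≈ ε 0<ε = δ , 0<δ , λ {a} {b} {s} {t} a≈b s≈t →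
    let a⁺≈b⁺ : ∀ W → clamp a W ≈[ δ ] clamp b W
        a⁺≈b⁺ W = ≈-⊔ (a≈b W) (≈-refl 0<δ)
        a⁺≈b⁺-δ₃ : ∀ W → clamp a W ≈[ δ₃ ] clamp b W
        a⁺≈b⁺-δ₃ W = ≈-weaken δ≤δ₃ (a⁺≈b⁺ W)
        τ≈ : time s ≈[ δ₀ ] time t
        τ≈ = time-≈ 0<δ₀ (≈-weaken δ≤¼δ₀ s≈t)
    in close₂
      (λ _ → ≈-⊔ (≈-− (≈-weaken δ₀≤½δ₂ τ≈) (≈-weaken δ₀≤½δ₂ (close₃ a⁺≈b⁺-δ₃))) (≈-refl 0<δ₂))
      (close₁
        (λ W → ≈-⊔ (≈-− (≈-weaken δ₀≤½δ₁ τ≈) (≈-weaken δ₀≤½δ₁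
            (close₃ λ T → when-≈ (W ⊏? T) 0<δ₃ (a⁺≈b⁺-δ₃ T)))) (≈-refl 0<δ₁))
        (λ W → ≈-weaken δ≤δ₁ (a⁺≈b⁺ W)))
    where
    -- The moduli are chosen from the last operation backwards: `δ₂` and `δ₁` for the two moves,
    -- `δ₀` for the two terms of each rate, `δ₃` for the sums inside the rates.
    modulus₂ = move-≈ (const c) ε 0<ε
    δ₂ = proj₁ modulus₂
    0<δ₂ = proj₁ (proj₂ modulus₂)
    close₂ = proj₂ (proj₂ modulus₂)
    modulus₁ = move-≈ g δ₂ 0<δ₂
    δ₁ = proj₁ modulus₁
    0<δ₁ = proj₁ (proj₂ modulus₁)
    close₁ = proj₂ (proj₂ modulus₁)
    δ₀ = (½ * δ₁) ⊓ (½ * δ₂)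
    0<δ₀ = ⊓-pos (half-pos 0<δ₁) (half-pos 0<δ₂)
    δ₀≤½δ₁ = ℚ.p⊓q≤p (½ * δ₁) (½ * δ₂)
    δ₀≤½δ₂ = ℚ.p⊓q≤q (½ * δ₁) (½ * δ₂)
    modulus₃ = sum-≈ (subsets m) δ₀ 0<δ₀
    δ₃ = proj₁ modulus₃
    0<δ₃ = proj₁ (proj₂ modulus₃)
    close₃ = proj₂ (proj₂ modulus₃)
    ¼δ₀ = ½ * (½ * δ₀)
    δ = (δ₃ ⊓ δ₁) ⊓ ¼δ₀
    0<δ = ⊓-pos (⊓-pos 0<δ₃ 0<δ₁) (half-pos (half-pos 0<δ₀))
    δ≤¼δ₀ = ℚ.p⊓q≤q (δ₃ ⊓ δ₁) ¼δ₀
    δ≤δ₃ = ℚ.≤-trans (ℚ.p⊓q≤p (δ₃ ⊓ δ₁) ¼δ₀) (ℚ.p⊓q≤p δ₃ δ₁)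
    δ≤δ₁ = ℚ.≤-trans (ℚ.p⊓q≤p (δ₃ ⊓ δ₁) ¼δ₀) (ℚ.p⊓q≤q δ₃ δ₁)

  -- The three ways for a label to carry mass at time s: it is the image under g
  -- of a label that has begun to move, it has not moved away yet, or it is c and
  -- the first stage is over.
  data Origin (P : Pred (Subset m) 0ℓ) (a : Subset m → ℚ) (s : ℚ) (v : Subset m) : Set where
    moved  : ∀ W → g W ≡ v → P W → above (clamp a) W < time s → Origin P a s v
    stayed : P v → time s < above (clamp a) v + clamp a v → Origin P a s v
    apex   : c ≡ v → mass (clamp a) < time s → Origin P a s v

  private
    δ≤x⊔0⇒δ≤x : ∀ {δ} x → 0ℚ < δ → δ ≤ x ⊔ 0ℚ → δ ≤ x
    δ≤x⊔0⇒δ≤x {δ} x 0<δ δ≤ with ℚ.⊔-sel x 0ℚ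
    ... | inj₁ eq = subst (δ ≤_) eq δ≤
    ... | inj₂ eq = contradiction (ℚ.<-≤-trans 0<δ (subst (δ ≤_) eq δ≤)) (ℚ.<-irrefl refl)

    δ≤⇒< : ∀ {δ} x y → 0ℚ < δ → δ ≤ (x - y) ⊔ 0ℚ → y < x
    δ≤⇒< x y 0<δ δ≤ = <-shift y (ℚ.<-≤-trans 0<δ (δ≤x⊔0⇒δ≤x (x - y) 0<δ δ≤))
      (ℚ.+-identityˡ y) (x-y+y x y)

    ⊔0+δ≤⇒δ≤ : ∀ {δ} x {y} → x ⊔ 0ℚ + δ ≤ y → δ ≤ y
    ⊔0+δ≤⇒δ≤ {δ} x = ℚ.≤-trans (y≤x+y δ (ℚ.p≤q⊔p x 0ℚ))

  abstract
    -- Mass is traced back through the two moves. The lower bound `δ ≤ a W` survives the tracing, so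
    -- that positivity of the real coordinate at `W` can be concluded from it.
    stage₂-origin : ∀ ε → 0ℚ < ε → ∃[ δ ] 0ℚ < δ ×
      (∀ {a s} v → ε ≤ stage₂ a s v → Origin (λ W → δ ≤ a W) a s v)
    stage₂-origin ε 0<ε with move-positive (const c) ε 0<ε
    ... | δ₂ , 0<δ₂ , locate₂ with move-positive g δ₂ 0<δ₂
    ...   | δ₁ , 0<δ₁ , locate₁ = δ₁ , 0<δ₁ , locate
      where
      locate : ∀ {a s} v → ε ≤ stage₂ a s v → Origin (λ W → δ₁ ≤ a W) a s v
      locate {a} {s} v ε≤ with locate₂ {rate₂ a s} {stage₁ a s} v ε≤
      ... | inj₂ (_ , c≡v , _ , δ≤) = apex c≡v (δ≤⇒< (time s) (mass (clamp a)) 0<δ₂ δ≤)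
      ... | inj₁ δ₂≤ with locate₁ {rate₁ a s} {clamp a} v (⊔0+δ≤⇒δ≤ (time s - mass (clamp a)) δ₂≤)
      ...   | inj₂ (W , gW≡v , δ≤a , δ≤r) = moved W gW≡v (δ≤x⊔0⇒δ≤x (a W) 0<δ₁ δ≤a)
        (δ≤⇒< (time s) (above (clamp a) W) 0<δ₁ δ≤r)
      ...   | inj₁ rest = stayed
        (δ≤x⊔0⇒δ≤x (a v) 0<δ₁ (⊔0+δ≤⇒δ≤ (time s - above (clamp a) v) rest))
        (<-shift (above (clamp a) v)
          (ℚ.<-≤-trans (ℚ.≤-<-trans (ℚ.p≤p⊔q (time s - above (clamp a) v) 0ℚ) (x<x+ε _ 0<δ₁))
                       rest)
          (x-y+y (time s) (above (clamp a) v)) (ℚ.+-comm (clamp a v) (above (clamp a) v)))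

-- The homotopy on the order complex

private variable
  P R : Pred ℕ 0ℓ

eventually-map : (∀ {k} → P k → R k) → Eventually P → Eventually R
eventually-map f (N , p) = N , λ k N≤k → f (p k N≤k)

eventually-× : Eventually P → Eventually R → Eventually (λ k → P k × R k)
eventually-× (M , p) (N , r) = M ℕ.⊔ N , λ k ≤k →
  p k (ℕ.m⊔n≤o⇒m≤o M N ≤k) , r k (ℕ.m⊔n≤o⇒n≤o M N ≤k)

eventually-∀ : ∀ {A : Set} {P : A → Pred ℕ 0ℓ} (xs : List A) → (∀ x → x ∈ˡ xs) →
  (∀ x → Eventually (P x)) → Eventually (λ k → ∀ x → P x k)
eventually-∀ {A} {P} xs complete p = eventually-map (λ f x → f (complete x)) (go xs)
  where
  go : ∀ xs → Eventually (λ k → ∀ {x} → x ∈ˡ xs → P x k)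
  go []       = 0 , λ _ _ ()
  go (x ∷ xs) = eventually-map (λ { (px , _) (here refl) → px ; (_ , f) (there x∈) → f x∈ })
    (eventually-× (p x) (go xs))

CauchyAfter : (ℕ → ℚ) → ℚ → Pred ℕ 0ℓ
CauchyAfter x ε N = ∀ {j k} → N ℕ.≤ j → N ℕ.≤ k → x j ≈[ ε ] x k

cauchy-eventually : ∀ x {ε} → 0ℚ < ε → Eventually (CauchyAfter (seq x) ε)
cauchy-eventually x {ε} 0<ε = let N , f = cauchy x ε 0<ε in N , λ M N≤M {j} {k} M≤j M≤k →
  ∣-∣<⇒≈ (seq x j) (seq x k) (f j k (ℕ.≤-trans N≤M M≤j) (ℕ.≤-trans N≤M M≤k))

module _ (x : ℝ) where

  -- `q` and `h` are a quarter and a half of `ε`. Were `seq x N` at most `- h`, all later terms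
  -- would lie below `- q`, and this fixed gap would give `x <ℝ 0ℝ`.
  0≤ℝ⇒above-after : 0ℝ ≤ℝ x → ∀ {ε h q N} → 0ℚ < q → q + q ≡ h → h + h ≡ ε →
    CauchyAfter (seq x) q N → ∀ k → N ℕ.≤ k → 0ℚ < seq x k + ε
  0≤ℝ⇒above-after 0≤x {ε} {h} {q} {N} 0<q q+q≡h h+h≡ε cauchyN k N≤k = begin-strict
    0ℚ                 <⟨ ℚ.≰⇒> not-below ⟩
    seq x N + h        <⟨ ℚ.+-monoˡ-< h (≈⇒< (cauchyN ℕ.≤-refl N≤k)) ⟩
    seq x k + q + h    <⟨ ℚ.+-monoˡ-< h (ℚ.+-monoʳ-< (seq x k) (subst (q <_) q+q≡h (x<x+ε q 0<q))) ⟩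
    seq x k + h + h    ≡⟨ ℚ.+-assoc (seq x k) h h ⟩
    seq x k + (h + h)  ≡⟨ cong (seq x k +_) h+h≡ε ⟩
    seq x k + ε        ∎
    where
    open ℚ.≤-Reasoning
    not-below : ¬ seq x N + h ≤ 0ℚ
    not-below below = 0≤x (q , 0<q , N , λ j N≤j → ℚ.<⇒≤ (begin-strict
      seq x j + q        <⟨ ℚ.+-monoˡ-< q (≈⇒> (cauchyN ℕ.≤-refl N≤j)) ⟩
      seq x N + q + q    ≡⟨ ℚ.+-assoc (seq x N) q q ⟩
      seq x N + (q + q)  ≡⟨ cong (seq x N +_) q+q≡h ⟩
      seq x N + h        ≤⟨ below ⟩
      0ℚ                 ∎))

  0≤ℝ⇒eventually : 0ℝ ≤ℝ x → ∀ {ε} → 0ℚ < ε → Eventually (λ k → 0ℚ < seq x k + ε)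
  0≤ℝ⇒eventually 0≤x {ε} 0<ε =
    let 0<q = half-pos (half-pos 0<ε)
        N , cauchyN = cauchy-eventually x 0<q
    in N , 0≤ℝ⇒above-after 0≤x 0<q (half+half (½ * ε)) (half+half ε) (cauchyN N ℕ.≤-refl)

  -- Late terms differ by less than half of `δ`, so a single one that reaches `δ` keeps all of them
  -- above the other half. This stands in for a decision whether `x` is positive.
  eventually-positive : ∀ {δ} → 0ℚ < δ → Eventually (λ k → δ ≤ seq x k → 0ℝ <ℝ x)
  eventually-positive {δ} 0<δ =
    let N , cauchyN = cauchy-eventually x (half-pos 0<δ)
    in N , λ k N≤k δ≤xk → ½ * δ , half-pos 0<δ , N , λ j N≤j →
      lower (ℚ.≤-<-trans δ≤xk (≈⇒< (cauchyN N ℕ.≤-refl N≤k N≤j)))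
    where
    lower : ∀ {y} → δ < y + ½ * δ → 0ℚ + ½ * δ ≤ y
    lower {y} δ<y+ = ℚ.<⇒≤ (<-shift (- (½ * δ)) δ<y+
      (trans (trans (cong (_- ½ * δ) (sym (half+half δ))) (x+y-y (½ * δ) (½ * δ)))
             (sym (ℚ.+-identityˡ _)))
      (x+y-y y (½ * δ)))

within⇒≈ : ∀ {δ} x y → Within δ x y → Eventually (λ k → seq x k ≈[ δ ] seq y k)
within⇒≈ {δ} x y (x<y , y<x) =
  eventually-map (λ (p , q) → p , q) (eventually-× (below x y x<y) (below y x y<x))
  where
  below : ∀ x y → x <ℝ y +ℝ fromℚ δ → Eventually (λ k → seq x k < seq y k + δ)
  below x y (ε , 0<ε , ev) =
    eventually-map (λ {k} → ℚ.<-≤-trans (x<x+ε (seq x k) 0<ε)) ev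

-- `_<ℝ_` asks for a gap that is constant along the sequence; the remaining half of `ε` provides it.
≈⇒within : ∀ {ε} x y → 0ℚ < ε → Eventually (λ k → seq x k ≈[ ½ * ε ] seq y k) → Within ε x y
≈⇒within {ε} x y 0<ε ev =
  (½ * ε , half-pos 0<ε , eventually-map (λ {k} p → widen (seq x k) (seq y k) (≈⇒< p)) ev) ,
  (½ * ε , half-pos 0<ε , eventually-map (λ {k} p → widen (seq y k) (seq x k) (≈⇒> p)) ev)
  where
  widen : ∀ a b → a < b + ½ * ε → a + ½ * ε ≤ b + ε
  widen a b a<b = ℚ.<⇒≤ (<-shift (½ * ε) a<b refl
    (trans (ℚ.+-assoc b (½ * ε) (½ * ε)) (cong (b +_) (half+half ε))))

sumℝ-seq : ∀ {A : Set} (f : A → ℝ) xs k →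
  seq (sumℝ (map f xs)) k ≡ sum (λ x → seq (f x) k) xs
sumℝ-seq f []       k = refl
sumℝ-seq f (x ∷ xs) k = cong (seq (f x) k +_) (sumℝ-seq f xs k)

Comparable : ∀ {m} → Rel (Subset m) 0ℓ
Comparable A B = A ⊆ B ⊎ B ⊆ A

-- `_⊑_` will be inclusion or its reverse, so that one homotopy serves closure operators and
-- interior operators.
module _ {m : ℕ} {_⊑_ : Rel (Subset m) 0ℓ} (isPO : IsPartialOrder _≡_ _⊑_)
  (_⊑?_ : B.Decidable _⊑_)
  (⊑⇒comparable : ∀ {A B} → A ⊑ B → Comparable A B)
  (⊆⇒⊑ : ∀ {A B} → A ⊆ B → A ⊑ B ⊎ B ⊑ A)
  {Q : Pred (Subset m) 0ℓ} (g : Subset m → Subset m) (c : Subset m)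
  (g-∈ : ∀ {A} → Q A → Q (g A)) (c-∈ : Q c)
  (⊑-g : ∀ {A} → Q A → A ⊑ g A)
  (g-mono : ∀ {A B} → Q A → Q B → A ⊑ B → g A ⊑ g B)
  (c⊑g : ∀ {A} → Q A → c ⊑ g A) where

  private
    module ⊑ = IsPartialOrder isPO
    open Transport {m}
    open Contraction isPO _⊑?_ g c

    coords : ∥ △ Q ∥ → ℕ → Subset m → ℚ
    coords p k v = seq (coord p v) k

    abstract
      -- Late approximations of a nonnegative real exceed `- ε`, so truncation at zero changes them
      -- by less than `ε`.
      clamp-≈ : ∀ p {ε} → 0ℚ < ε →
        Eventually (λ k → ∀ v → clamp (coords p k) v ≈[ ε ] coords p k v)
      clamp-≈ p {ε} 0<ε = eventually-∀ (subsets m) subsets-complete λ v →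
        eventually-map (λ {k} → close (coords p k v)) (0≤ℝ⇒eventually (coord p v) (nonneg p v) 0<ε)
        where
        below : ∀ x → 0ℚ < x + ε → x ⊔ 0ℚ < x + ε
        below x 0<x+ε with ℚ.⊔-sel x 0ℚ
        ... | inj₁ eq = subst (_< x + ε) (sym eq) (x<x+ε x 0<ε)
        ... | inj₂ eq = subst (_< x + ε) (sym eq) 0<x+ε
        close : ∀ x → 0ℚ < x + ε → x ⊔ 0ℚ ≈[ ε ] x
        close x 0<x+ε = below x 0<x+ε , ℚ.≤-<-trans (ℚ.p≤p⊔q x 0ℚ) (x<x+ε (x ⊔ 0ℚ) 0<ε)

      mass-≈ : ∀ p {ε} → 0ℚ < ε → Eventually (λ k → mass (clamp (coords p k)) ≈[ ε ] 1ℚ)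
      mass-≈ p {ε} 0<ε with sum-≈ (subsets m) (½ * ε) (half-pos 0<ε)
      ... | δ , 0<δ , sum-close = eventually-map (λ (close , |-|<) → ≈-trans (sum-close close) |-|<)
        (eventually-× (clamp-≈ p 0<δ)
          (eventually-map (λ {k} |-|< → subst (_≈[ ½ * ε ] 1ℚ) (sumℝ-seq (coord p) (subsets m) k)
              (∣-∣<⇒≈ _ 1ℚ |-|<))
            (total p (½ * ε) (half-pos 0<ε))))

    coordH : ∥ △ Q ∥ → 𝕀 → Subset m → ℝ
    coordH p t v .seq k = stage₂ (coords p k) (seq (value t) k) v
    coordH p t v .cauchy ε 0<ε =
      let δ , 0<δ , close = stage₂-≈ ε 0<ε
          N , f = eventually-×
            (eventually-∀ (subsets m) subsets-complete λ W → cauchy-eventually (coord p W) 0<δ)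
            (cauchy-eventually (value t) 0<δ)
      in N , λ j k N≤j N≤k → ≈⇒∣-∣< (coordH p t v .seq j) (coordH p t v .seq k)
        (close (λ W → proj₁ (f N ℕ.≤-refl) W N≤j N≤k) (proj₂ (f N ℕ.≤-refl) N≤j N≤k) v)

    abstract
      -- Masses and times are compared on approximations, so the origin may vary with the index; a
      -- single late index is enough to verify a face.
      origin : ∀ p t {v} → 0ℝ <ℝ coordH p t v →
        Eventually (λ k → Origin (λ W → 0ℝ <ℝ coord p W) (coords p k) (seq (value t) k) v)
      origin p t {v} (ε , 0<ε , ε≤) with stage₂-origin ε 0<ε
      ... | δ , 0<δ , locate = eventually-map
        (λ (pos , ε≤) → map-origin pos (locate v (subst (_≤ _) (ℚ.+-identityˡ ε) ε≤)))
        (eventually-×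
          (eventually-∀ (subsets m) subsets-complete λ W → eventually-positive (coord p W) 0<δ) ε≤)
        where
        map-origin : ∀ {P P′ : Pred (Subset m) 0ℓ} {a s} → (∀ W → P W → P′ W) →
          Origin P a s v → Origin P′ a s v
        map-origin f (moved W gW≡v PW a<s) = moved W gW≡v (f W PW) a<s
        map-origin f (stayed Pv s<a)       = stayed (f v Pv) s<a
        map-origin f (apex c≡v a<s)        = apex c≡v a<s

    module _ (p : ∥ △ Q ∥) {a : Subset m → ℚ} {s : ℚ} where

      private
        O : Pred (Subset m) 0ℓ
        O = Origin (λ W → 0ℝ <ℝ coord p W) a s

        carrier-∈ : ∀ {A} → 0ℝ <ℝ coord p A → Q A
        carrier-∈ {A} 0<A = All.head (proj₁ (support p (A ∷ []) (0<A All.∷ All.[])))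

        carrier-chain : ∀ {A B} → 0ℝ <ℝ coord p A → 0ℝ <ℝ coord p B → A ⊑ B ⊎ B ⊑ A
        carrier-chain {A} {B} 0<A 0<B = [ ⊆⇒⊑ , swap ∘ ⊆⇒⊑ ]′
          (proj₂ (support p (A ∷ B ∷ []) (0<A All.∷ 0<B All.∷ All.[]))
            (here refl) (there (here refl)))

      origin-∈ : ∀ {A} → O A → Q A
      origin-∈ (moved W refl 0<W _) = g-∈ (carrier-∈ 0<W)
      origin-∈ (stayed 0<A _)       = carrier-∈ 0<A
      origin-∈ (apex refl _)        = c-∈

      -- The higher label of a chain moves first: were `W` strictly below `B`, it could not have
      -- begun before `B` had finished. Hence `B ⊑ W ⊑ g W`.
      moved-stayed : ∀ {W B} → 0ℝ <ℝ coord p W → above (clamp a) W < time s →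
        0ℝ <ℝ coord p B → time s < above (clamp a) B + clamp a B → g W ⊑ B ⊎ B ⊑ g W
      moved-stayed {W} {B} 0<W W< 0<B <B with W ≟ˢ B
      ... | yes refl = inj₂ (⊑-g (carrier-∈ 0<B))
      ... | no W≢B with carrier-chain 0<W 0<B
      ...   | inj₂ B⊑W = inj₂ (⊑.trans B⊑W (⊑-g (carrier-∈ 0<W)))
      ...   | inj₁ W⊑B = contradiction (ℚ.<-trans W< (ℚ.<-≤-trans <B
                (above-≤ (W ⊏?_) (clamp-nonneg a) (W⊑B , W≢B)
                  λ (B⊑T , B≢T) → ⊑.trans W⊑B B⊑T ,
                    λ { refl → W≢B (⊑.antisym W⊑B B⊑T) })))
                (ℚ.<-irrefl refl)

      -- Mass is sent to `c` only after the time `mass (clamp a)`, by which every label has finished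
      -- the first stage.
      stayed-before-apex : ∀ {A : Set} {B} → time s < above (clamp a) B + clamp a B →
        mass (clamp a) < time s → A
      stayed-before-apex <B m< = contradiction (ℚ.<-trans m< (ℚ.<-≤-trans <B
        (above-≤ (λ _ → yes tt) (clamp-nonneg a) tt λ _ → tt))) (ℚ.<-irrefl refl)

      origin-chain : ∀ {A B} → O A → O B → A ⊑ B ⊎ B ⊑ A
      origin-chain (moved W refl 0<W _) (moved W′ refl 0<W′ _) =
        [ inj₁ ∘ g-mono (carrier-∈ 0<W) (carrier-∈ 0<W′)
        , inj₂ ∘ g-mono (carrier-∈ 0<W′) (carrier-∈ 0<W) ]′ (carrier-chain 0<W 0<W′)
      origin-chain (moved W refl 0<W W<) (stayed 0<B <B)    = moved-stayed 0<W W< 0<B <B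
      origin-chain (moved W refl 0<W _)  (apex refl _)      = inj₂ (c⊑g (carrier-∈ 0<W))
      origin-chain (stayed 0<A <A) (moved W refl 0<W W<)    = swap (moved-stayed 0<W W< 0<A <A)
      origin-chain (stayed 0<A _)  (stayed 0<B _)           = carrier-chain 0<A 0<B
      origin-chain (stayed _ <A)   (apex _ m<)              = stayed-before-apex <A m<
      origin-chain (apex refl _)   (moved W refl 0<W _)     = inj₁ (c⊑g (carrier-∈ 0<W))
      origin-chain (apex _ m<)     (stayed _ <B)            = stayed-before-apex <B m<
      origin-chain (apex refl _)   (apex refl _)            = inj₁ ⊑.refl

    H : ∥ △ Q ∥ → 𝕀 → ∥ △ Q ∥
    H p t .coord = coordH p t
    H p t .nonneg v (ε , 0<ε , N , f) = ℚ.<-irrefl refl (ℚ.<-≤-trans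
      (ℚ.≤-<-trans (stage₂-nonneg (coords p N) (seq (value t) N) v) (x<x+ε _ 0<ε)) (f N ℕ.≤-refl))
    H p t .total ε 0<ε = eventually-map
      (λ {k} close → ≈⇒∣-∣< (seq (sumℝ (map (coordH p t) (subsets m))) k) 1ℚ (subst (_≈[ ε ] 1ℚ)
        (sym (trans (sumℝ-seq (coordH p t) (subsets m) k)
                    (stage₂-mass (coords p k) (seq (value t) k)))) close))
      (mass-≈ p 0<ε)
    H p t .support σ 0<σ = All.map in-Q 0<σ , λ A∈σ B∈σ →
      chain (All.lookup 0<σ A∈σ) (All.lookup 0<σ B∈σ)
      where
      in-Q : ∀ {A} → 0ℝ <ℝ coordH p t A → Q A
      in-Q 0<A = let N , O = origin p t 0<A in origin-∈ p (O N ℕ.≤-refl)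
      chain : ∀ {A B} → 0ℝ <ℝ coordH p t A → 0ℝ <ℝ coordH p t B → Comparable A B
      chain 0<A 0<B =
        let N , O = eventually-× (origin p t 0<A) (origin p t 0<B)
        in [ ⊑⇒comparable , swap ∘ ⊑⇒comparable ]′
             (origin-chain p (proj₁ (O N ℕ.≤-refl)) (proj₂ (O N ℕ.≤-refl)))

    apexPoint : ∥ △ Q ∥
    apexPoint .coord v = fromℚ (when (c ≟ˢ v) 1ℚ)
    apexPoint .nonneg v (ε , 0<ε , N , f) = ℚ.<-irrefl refl (ℚ.<-≤-trans
      (ℚ.≤-<-trans (when-nonneg (c ≟ˢ v) (ℚ.nonNegative⁻¹ 1ℚ)) (x<x+ε _ 0<ε)) (f N ℕ.≤-refl))
    apexPoint .total ε 0<ε = 0 , λ k _ →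
      ≈⇒∣-∣< (seq (sumℝ (map (apexPoint .coord) (subsets m))) k) 1ℚ (subst (_≈[ ε ] 1ℚ)
        (sym (trans (sumℝ-seq (apexPoint .coord) (subsets m) k)
          (sum-point _≟ˢ_ (λ _ → 1ℚ) (subsets-unique m) (subsets-complete c)))) (≈-refl 0<ε))
    apexPoint .support σ 0<σ = All.map (λ 0<A → subst Q (is-c 0<A) c-∈) 0<σ , λ A∈σ B∈σ →
      inj₁ (⊆-reflexive (trans (sym (is-c (All.lookup 0<σ A∈σ))) (is-c (All.lookup 0<σ B∈σ))))
      where
      is-c : ∀ {A} → 0ℝ <ℝ fromℚ (when (c ≟ˢ A) 1ℚ) → c ≡ A
      is-c {A} (ε , 0<ε , N , f) = proj₁ (when-positive (c ≟ˢ A) 0<ε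
        (subst (_≤ when (c ≟ˢ A) 1ℚ) (ℚ.+-identityˡ ε) (f N ℕ.≤-refl)))

    H-continuous : Continuous H
    H-continuous p s ε 0<ε = let δ , 0<δ , close = stage₂-≈ (½ * ε) (half-pos 0<ε) in
      δ , 0<δ , λ q t p≈q s≈t v →
      ≈⇒within (coordH p s v) (coordH q t v) 0<ε (eventually-map
        (λ (p≈q , s≈t) → close p≈q s≈t v)
        (eventually-×
          (eventually-∀ (subsets m) subsets-complete
            λ W → within⇒≈ (coord p W) (coord q W) (p≈q W))
          (within⇒≈ (value s) (value t) s≈t)))

    H-start : ∀ p → H p 0𝕀 ≈∥ p
    H-start p v ε 0<ε = eventually-map
      (λ {k} close → ≈⇒∣-∣< (coordH p 0𝕀 v .seq k) (coords p k v)
        (subst (_≈[ ε ] coords p k v) (sym (stage₂-start (coords p k) v)) (close v)))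
      (clamp-≈ p 0<ε)

    H-end : ∀ p → H p 1𝕀 ≈∥ apexPoint
    H-end p v ε 0<ε = eventually-map
      (λ {k} (close₁ , close) → ≈⇒∣-∣< (coordH p 1𝕀 v .seq k) (when (c ≟ˢ v) 1ℚ)
        (subst (_≈[ ε ] when (c ≟ˢ v) 1ℚ)
          (sym (stage₂-end (coords p k) (ℚ.<⇒≤ (≈⇒< close₁)) v))
          (when-≈ (c ≟ˢ v) 0<ε close)))
      -- The tolerance 1 bounds the mass by `1ℚ + 1ℚ`, as `stage₂-end` requires.
      (eventually-× (mass-≈ p (ℚ.positive⁻¹ 1ℚ)) (mass-≈ p 0<ε))

  contractible : Contractible (△ Q)
  contractible = apexPoint , H , H-continuous , H-start , H-end

-- The closure operator on an irregular interval

IsBipartitional : ∀ {A : Set} → Rel A 0ℓ → Set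
IsBipartitional R = Transitive R × Transitive (λ x y → ¬ R x y)

-- A way to read subsets of Fin (n * n) as relations that identifies _⊑_ with
-- inclusion and Bip n with the bipartitional relations.  Transposition and
-- complementation give three further readings besides the obvious one.
record Reading (n : ℕ) (_⊑_ : Rel (Relation n) 0ℓ) : Set₁ where
  field
    ⟦_⟧    : Relation n → Rel (Fin n) 0ℓ
    ⟦_⟧?   : ∀ W → B.Decidable ⟦ W ⟧
    build  : {R : Rel (Fin n) 0ℓ} → B.Decidable R → Relation n
    build⁺ : ∀ {R} (R? : B.Decidable R) {x y} → R x y → ⟦ build R? ⟧ x y
    build⁻ : ∀ {R} (R? : B.Decidable R) {x y} → ⟦ build R? ⟧ x y → R x y
    ⊑⇒     : ∀ {W T x y} → W ⊑ T → ⟦ W ⟧ x y → ⟦ T ⟧ x y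
    ⇒⊑     : ∀ {W T} → (∀ {x y} → ⟦ W ⟧ x y → ⟦ T ⟧ x y) → W ⊑ T
    bip⇒   : ∀ {W} → Bip n W → IsBipartitional ⟦ W ⟧
    ⇒bip   : ∀ {W} → IsBipartitional ⟦ W ⟧ → Bip n W

direct : ∀ n → Reading n _⊆_
direct n = record
  { ⟦_⟧    = Holds n
  ; ⟦_⟧?   = λ W x y → combine x y ∈? W
  ; build  = build
  ; build⁺ = λ R? {x} {y} r → lookup⇒[]= (combine x y) _
      (trans (lookup-build R? x y) (dec-true (R? x y) r))
  ; build⁻ = λ R? {x} {y} b → does⁻ (R? x y) (trans (sym (lookup-build R? x y)) ([]=⇒lookup b))
  ; ⊑⇒     = λ W⊆T → W⊆T
  ; ⇒⊑     = λ {W} {T} f {i} → subst (λ j → j ∈ W → j ∈ T) (combine-remQuot {n} n i) f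
  ; bip⇒   = λ b → b
  ; ⇒bip   = λ b → b
  }
  where
  build : {R : Rel (Fin n) 0ℓ} → B.Decidable R → Relation n
  build R? = tabulate (λ i → does (uncurry R? (remQuot n i)))

  lookup-build : ∀ {R} (R? : B.Decidable R) x y → lookup (build R?) (combine x y) ≡ does (R? x y)
  lookup-build R? x y = trans (lookup∘tabulate _ (combine x y))
    (cong (λ q → does (uncurry R? q)) (remQuot-combine x y))

  does⁻ : ∀ {P : Set} (P? : Dec P) → does P? ≡ true → P
  does⁻ (yes p) _ = p

transpose : ∀ {n _⊑_} → Reading n _⊑_ → Reading n _⊑_
transpose r = record
  { ⟦_⟧    = λ W → flip ⟦ W ⟧
  ; ⟦_⟧?   = λ W → flip ⟦ W ⟧?
  ; build  = λ R? → build (flip R?)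
  ; build⁺ = λ R? → build⁺ (flip R?)
  ; build⁻ = λ R? → build⁻ (flip R?)
  ; ⊑⇒     = ⊑⇒
  ; ⇒⊑     = λ f → ⇒⊑ f
  ; bip⇒   = λ b → flip (proj₁ (bip⇒ b)) , flip (proj₂ (bip⇒ b))
  ; ⇒bip   = λ (t , u) → ⇒bip (flip t , flip u)
  }
  where open Reading r

-- Complementation exchanges the two transitivity conditions; decidability removes the double
-- negations.
complement : ∀ {n _⊑_} → Reading n _⊑_ → Reading n (flip _⊑_)
complement r = record
  { ⟦_⟧    = λ W x y → ¬ ⟦ W ⟧ x y
  ; ⟦_⟧?   = λ W x y → ¬? (⟦ W ⟧? x y)
  ; build  = λ R? → build (λ x y → ¬? (R? x y))
  ; build⁺ = λ R? p q → build⁻ (λ x y → ¬? (R? x y)) q p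
  ; build⁻ = λ R? {x} {y} ¬b → decidable-stable (R? x y) λ ¬p → ¬b (build⁺ (λ x y → ¬? (R? x y)) ¬p)
  ; ⊑⇒     = λ T⊑W ¬w t → ¬w (⊑⇒ T⊑W t)
  ; ⇒⊑     = λ {W} {T} f → ⇒⊑ λ {x} {y} t → decidable-stable (⟦ W ⟧? x y) λ ¬w → f ¬w t
  ; bip⇒   = λ {W} b → let t , u = bip⇒ b in u , λ {x} {y} {z} ¬¬p ¬¬q ¬r →
      ¬¬p λ p → ¬¬q λ q → ¬r (t p q)
  ; ⇒bip   = λ {W} (u , t) → ⇒bip ((λ {x} {y} {z} p q →
      decidable-stable (⟦ W ⟧? x z) (t (λ ¬p → ¬p p) (λ ¬q → ¬q q))) , u)
  }
  where open Reading r

Between : ∀ n → Rel (Relation n) 0ℓ → (L G : Relation n) → Pred (Relation n) 0ℓ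
Between n _⊑_ L G W = Bip n W × L ⊑ W × W ⊑ G

-- `g≢L` includes the case `W = L`, so that `g L`, the apex of the contraction, differs from `L`.
record ClosureOperator (n : ℕ) (_⊑_ : Rel (Relation n) 0ℓ) (L G : Relation n) : Set where
  field
    g      : Relation n → Relation n
    g-∈    : ∀ {W} → Between n _⊑_ L G W → Between n _⊑_ L G (g W)
    ⊑-g    : ∀ {W} → W ⊑ g W
    g-mono : ∀ {W T} → W ⊑ T → g W ⊑ g T
    g-idem : ∀ {W} → Between n _⊑_ L G W → g (g W) ⊑ g W
    g≢L    : ∀ {W} → Between n _⊑_ L G W → g W ≢ L
    g≢G    : ∀ {W} → Between n _⊑_ L G W → W ≢ G → g W ≢ G

-- In the reading at hand x lies in a non-underlined block of L, in an underlined
-- block of G, and y in the former but before the latter.  The block of x in L is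
-- split into A, the part before the block of x in G, and the rest B; g is the join
-- with L ∪ A × B.
module _ {n _⊑_} (isPO : IsPartialOrder _≡_ _⊑_) (r : Reading n _⊑_) {L G : Relation n}
  (L-bip : Bip n L) (G-bip : Bip n G) (L⊑G : L ⊑ G) where

  open Reading r
  private module ⊑ = IsPartialOrder isPO

  module _ (x y : Fin n) (Gxx : ⟦ G ⟧ x x) (¬Lxx : ¬ ⟦ L ⟧ x x)
    (¬Gxy : ¬ ⟦ G ⟧ x y) (¬Lyx : ¬ ⟦ L ⟧ y x) where

    private
      -- `¬ ⟦ G ⟧ x b` and `L ⊑ G` give `¬ ⟦ L ⟧ x b`, so `A` is indeed part of the block of `x` in
      -- `L`.
      A B : Pred (Fin n) 0ℓ
      A  b = ¬ ⟦ G ⟧ x b × ¬ ⟦ L ⟧ b x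
      B a = ⟦ G ⟧ x a × ¬ ⟦ L ⟧ x a × ¬ ⟦ L ⟧ a x

      A? : Decidable A
      A? b = ¬? (⟦ G ⟧? x b) ×-dec ¬? (⟦ L ⟧? b x)

      B? : Decidable B
      B? a = ⟦ G ⟧? x a ×-dec (¬? (⟦ L ⟧? x a) ×-dec ¬? (⟦ L ⟧? a x))

      Ay : A y
      Ay = ¬Gxy , ¬Lyx

      Bx : B x
      Bx = Gxx , ¬Lxx , ¬Lxx

      Before After : Relation n → Pred (Fin n) 0ℓ
      Before W p = A p ⊎ ∃[ b ] A b × ⟦ W ⟧ p b
      After  W q = B q ⊎ ∃[ a ] B a × ⟦ W ⟧ a q

      Joined : Relation n → Rel (Fin n) 0ℓ
      Joined W p q = ⟦ W ⟧ p q ⊎ Before W p × After W q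

      joined? : ∀ W → B.Decidable (Joined W)
      joined? W p q = ⟦ W ⟧? p q ⊎-dec
        ((A? p ⊎-dec any? λ b → A? b ×-dec ⟦ W ⟧? p b) ×-dec
         (B? q ⊎-dec any? λ a → B? a ×-dec ⟦ W ⟧? a q))

      g : Relation n → Relation n
      g W = build (joined? W)

      joined⁺ : ∀ {W p q} → Joined W p q → ⟦ g W ⟧ p q
      joined⁺ {W} = build⁺ (joined? W)

      joined⁻ : ∀ {W p q} → ⟦ g W ⟧ p q → Joined W p q
      joined⁻ {W} = build⁻ (joined? W)

      -- With `T` equal to `G`, `g W` and `W` this gives, in turn, that `g` stays in the interval,
      -- that it is idempotent, and that `g W = G` forces `G ⊑ W`.
      joined-least : ∀ {W T} → Transitive ⟦ T ⟧ → (∀ {b a} → A b → B a → ⟦ T ⟧ b a) → W ⊑ T →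
        ∀ {p q} → Joined W p q → ⟦ T ⟧ p q
      joined-least {W} {T} T-trans A×B⊆T W⊑T (inj₁ w) = ⊑⇒ W⊑T w
      joined-least {W} {T} T-trans A×B⊆T W⊑T (inj₂ (before , after)) = link before after
        where
        link : ∀ {p q} → Before W p → After W q → ⟦ T ⟧ p q
        link (inj₁ Ap)            (inj₁ Bq)            = A×B⊆T Ap Bq
        link (inj₁ Ap)            (inj₂ (_ , Ba , aq)) = T-trans (A×B⊆T Ap Ba) (⊑⇒ W⊑T aq)
        link (inj₂ (_ , Ab , pb)) (inj₁ Bq)            = T-trans (⊑⇒ W⊑T pb) (A×B⊆T Ab Bq)
        link (inj₂ (_ , Ab , pb)) (inj₂ (_ , Ba , aq)) =
          T-trans (⊑⇒ W⊑T pb) (T-trans (A×B⊆T Ab Ba) (⊑⇒ W⊑T aq))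

      A×B⊆g : ∀ {W b a} → A b → B a → ⟦ g W ⟧ b a
      A×B⊆g Ab Ba = joined⁺ (inj₂ (inj₁ Ab , inj₁ Ba))

      A×B⊆G : ∀ {b a} → A b → B a → ⟦ G ⟧ b a
      A×B⊆G {b} {a} (¬Gxb , _) (Gxa , _) = decidable-stable (⟦ G ⟧? b a) λ ¬Gba →
        proj₂ (bip⇒ G-bip) ¬Gxb ¬Gba Gxa

      -- Of two successive passages through `A × B`, the first entrance and the last exit already
      -- make a single passage.
      joined-trans : ∀ {W} → Transitive ⟦ W ⟧ → Transitive (Joined W)
      joined-trans t (inj₁ pq)         (inj₁ qr)         = inj₁ (t pq qr)
      joined-trans t (inj₁ pq)         (inj₂ (inj₁ Aq , after)) = inj₂ (inj₂ (_ , Aq , pq) , after)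
      joined-trans t (inj₁ pq)         (inj₂ (inj₂ (_ , Ab , qb) , after)) =
        inj₂ (inj₂ (_ , Ab , t pq qb) , after)
      joined-trans t (inj₂ (before , inj₁ Bq)) (inj₁ qr) = inj₂ (before , inj₂ (_ , Bq , qr))
      joined-trans t (inj₂ (before , inj₂ (_ , Ba , aq))) (inj₁ qr) =
        inj₂ (before , inj₂ (_ , Ba , t aq qr))
      joined-trans t (inj₂ (before , _)) (inj₂ (_ , after)) = inj₂ (before , after)

      -- Cotransitivity needs every intermediate `w` on one side. After the block of `x` in `L`, `w`
      -- is reached from `x` in `B`; before it, `w` reaches `y` in `A`; inside it, `w` belongs to
      -- `A` or to `B`.
      cover : ∀ {W} → L ⊑ W → ∀ w → Before W w ⊎ After W w
      cover L⊑W w with ⟦ L ⟧? x w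
      ... | yes Lxw = inj₂ (inj₂ (x , Bx , ⊑⇒ L⊑W Lxw))
      ... | no ¬Lxw with ⟦ L ⟧? w x
      ...   | yes Lwx = inj₁ (inj₂ (y , Ay , ⊑⇒ L⊑W (decidable-stable (⟦ L ⟧? w y) λ ¬Lwy →
                proj₂ (bip⇒ L-bip) ¬Lwy ¬Lyx Lwx)))
      ...   | no ¬Lwx with ⟦ G ⟧? x w
      ...     | yes Gxw = inj₂ (inj₁ (Gxw , ¬Lxw , ¬Lwx))
      ...     | no ¬Gxw = inj₁ (inj₁ (¬Gxw , ¬Lwx))

      joined-cotrans : ∀ {W} → L ⊑ W → Transitive (λ p q → ¬ ⟦ W ⟧ p q) →
        Transitive (λ p q → ¬ Joined W p q)
      joined-cotrans L⊑W u ¬pw ¬wq (inj₁ pq) = u (¬pw ∘ inj₁) (¬wq ∘ inj₁) pq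
      joined-cotrans L⊑W u {j = w} ¬pw ¬wq (inj₂ (before , after)) =
        [ (λ before′ → ¬wq (inj₂ (before′ , after)))
        , (λ after′ → ¬pw (inj₂ (before , after′))) ]′ (cover L⊑W w)

      g-trans : ∀ {W} → Bip n W → Transitive ⟦ g W ⟧
      g-trans W-bip p q = joined⁺ (joined-trans (proj₁ (bip⇒ W-bip)) (joined⁻ p) (joined⁻ q))

      ⊑-g : ∀ {W} → W ⊑ g W
      ⊑-g = ⇒⊑ (joined⁺ ∘ inj₁)

      g-mono : ∀ {W T} → W ⊑ T → g W ⊑ g T
      g-mono {W} {T} W⊑T = ⇒⊑ (joined⁺ ∘ mono ∘ joined⁻)
        where
        mono : ∀ {p q} → Joined W p q → Joined T p q
        mono (inj₁ w)                = inj₁ (⊑⇒ W⊑T w)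
        mono (inj₂ (before , after)) = inj₂
          ( [ inj₁ , (λ (b , Ab , pb) → inj₂ (b , Ab , ⊑⇒ W⊑T pb)) ]′ before
          , [ inj₁ , (λ (a , Ba , aq) → inj₂ (a , Ba , ⊑⇒ W⊑T aq)) ]′ after )

      g-∈ : ∀ {W} → Between n _⊑_ L G W → Between n _⊑_ L G (g W)
      g-∈ (W-bip , L⊑W , W⊑G) =
        ⇒bip (g-trans W-bip , λ ¬p ¬q → joined-cotrans L⊑W (proj₂ (bip⇒ W-bip))
          (¬p ∘ joined⁺) (¬q ∘ joined⁺) ∘ joined⁻) ,
        ⊑.trans L⊑W ⊑-g ,
        ⇒⊑ (joined-least (proj₁ (bip⇒ G-bip)) A×B⊆G W⊑G ∘ joined⁻)

      -- W and g W relate x to the same elements, so if g W = G then W already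
      -- contains A × B.
      g≡G⇒G⊑W : ∀ {W} → Between n _⊑_ L G W → g W ≡ G → G ⊑ W
      g≡G⇒G⊑W {W} (W-bip , _ , W⊑G) gW≡G =
        ⇒⊑ (joined-least (proj₁ (bip⇒ W-bip)) A×B⊆W ⊑.refl ∘ G⇒joined)
        where
        G⇒joined : ∀ {p q} → ⟦ G ⟧ p q → Joined W p q
        G⇒joined Gpq = joined⁻ (subst (λ T → ⟦ T ⟧ _ _) (sym gW≡G) Gpq)

        row-x : ∀ {z} → Joined W x z → ⟦ W ⟧ x z
        -- No passage through `A × B` begins at `x`: `G`, which contains `W`, relates `x` to itself
        -- but to no element of `A`.
        row-x (inj₁ Wxz)                                   = Wxz
        row-x (inj₂ (inj₁ (¬Gxx , _) , _))                 = contradiction Gxx ¬Gxx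
        row-x (inj₂ (inj₂ (_ , (¬Gxb , _) , Wxb) , _))     = contradiction (⊑⇒ W⊑G Wxb) ¬Gxb

        A×B⊆W : ∀ {b a} → A b → B a → ⟦ W ⟧ b a
        A×B⊆W {b} {a} (¬Gxb , _) (Gxa , _) = decidable-stable (⟦ W ⟧? b a) λ ¬Wba →
          proj₂ (bip⇒ W-bip) (¬Gxb ∘ ⊑⇒ W⊑G) ¬Wba (row-x (G⇒joined Gxa))

    closureOperator : ClosureOperator n _⊑_ L G
    closureOperator = record
      { g      = g
      ; g-∈    = g-∈
      ; ⊑-g    = ⊑-g
      ; g-mono = g-mono
      ; g-idem = λ (W-bip , _) → ⇒⊑ (joined-least (g-trans W-bip) A×B⊆g ⊑.refl ∘ joined⁻)
      ; g≢L    = λ _ gW≡L → ¬Lyx (subst (λ T → ⟦ T ⟧ y x) gW≡L (A×B⊆g Ay Bx))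
      ; g≢G    = λ W∈ W≢G gW≡G → W≢G (⊑.antisym (proj₂ (proj₂ W∈)) (g≡G⇒G⊑W W∈ gW≡G))
      }

-- Irregular pairs and the two cases

module _ (n : ℕ) {U V : Relation n} (U-bip : Bip n U) (V-bip : Bip n V) (U⊆V : U ⊆ V) where

  -- The four alternatives are the hypotheses of `closureOperator` on `x` and `y` in four readings:
  -- direct, transposed, complemented, and both. The last two exchange the roles of `U` and `V`.
  Irregular : Fin n → Fin n → Set
  Irregular x y = (Holds n V x x × ¬ Holds n U x x) ×
    ((¬ Holds n V x y × ¬ Holds n U y x ⊎ ¬ Holds n V y x × ¬ Holds n U x y) ⊎
     (Holds n U x y × Holds n V y x ⊎ Holds n U y x × Holds n V x y))

  irregular? : B.Decidable Irregular
  irregular? x y = (V? x x ×-dec ¬? (U? x x)) ×-dec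
    ((¬? (V? x y) ×-dec ¬? (U? y x) ⊎-dec ¬? (V? y x) ×-dec ¬? (U? x y)) ⊎-dec
     (U? x y ×-dec V? y x ⊎-dec U? y x ×-dec V? x y))
    where
    U? V? : B.Decidable _
    U? x y = combine x y ∈? U
    V? x y = combine x y ∈? V

  -- By bipartitionality, the block of `x` consists of elements unrelated to `x` in `U` and of
  -- elements related to it both ways in `V`. Any difference between these blocks is one of the four
  -- alternatives.
  irregular-pair : ¬ Regular n U V → ∃[ x ] ∃[ y ] Irregular x y
  irregular-pair ¬regular with any? (λ x → any? (irregular? x))
  ... | yes found = found
  ... | no ¬found = contradiction regular ¬regular
    where
    regular : Regular n U V
    regular x Vxx ¬Uxx = (λ {y} → U⇒V y) , (λ {y} → V⇒U y)
      where
      none : ∀ {y} → ¬ ((¬ Holds n V x y × ¬ Holds n U y x ⊎ ¬ Holds n V y x × ¬ Holds n U x y) ⊎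
                        (Holds n U x y × Holds n V y x ⊎ Holds n U y x × Holds n V x y))
      none {y} w = ¬found (x , y , (Vxx , ¬Uxx) , w)

      U⇒V : ∀ y → Equiv n U x y → Equiv n V x y
      U⇒V y (inj₁ (Uxy , Uyx))   = contradiction (proj₁ U-bip Uxy Uyx) ¬Uxx
      U⇒V y (inj₂ (¬Uxy , ¬Uyx)) = inj₁
        ( decidable-stable (combine x y ∈? V) (λ ¬Vxy → none (inj₁ (inj₁ (¬Vxy , ¬Uyx))))
        , decidable-stable (combine y x ∈? V) (λ ¬Vyx → none (inj₁ (inj₂ (¬Vyx , ¬Uxy)))) )

      V⇒U : ∀ y → Equiv n V x y → Equiv n U x y
      V⇒U y (inj₁ (Vxy , Vyx))   = inj₂
        ( (λ Uxy → none (inj₂ (inj₁ (Uxy , Vyx))))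
        , (λ Uyx → none (inj₂ (inj₂ (Uyx , Vxy)))) )
      V⇒U y (inj₂ (¬Vxy , ¬Vyx)) = contradiction Vxx (proj₂ V-bip ¬Vxy ¬Vyx)

  irregular⇒closureOperator : ∀ {x y} → Irregular x y →
    ClosureOperator n _⊆_ U V ⊎ ClosureOperator n (flip _⊆_) V U
  irregular⇒closureOperator {x} {y} ((Vxx , ¬Uxx) , inj₁ w) = inj₁ ([
      (λ (¬Vxy , ¬Uyx) → closure (direct n) Vxx ¬Uxx ¬Vxy ¬Uyx) ,
      (λ (¬Vyx , ¬Uxy) → closure (transpose (direct n)) Vxx ¬Uxx ¬Vyx ¬Uxy) ]′ w)
    where
    closure = λ r → closureOperator (⊆-isPartialOrder _) r U-bip V-bip U⊆V x y
  irregular⇒closureOperator {x} {y} ((Vxx , ¬Uxx) , inj₂ w) = inj₂ ([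
      (λ (Uxy , Vyx) → closure (complement (direct n))
        ¬Uxx (_$ Vxx) (_$ Uxy) (_$ Vyx)) ,
      (λ (Uyx , Vxy) → closure (complement (transpose (direct n)))
        ¬Uxx (_$ Vxx) (_$ Uyx) (_$ Vxy)) ]′ w)
    where
    closure = λ r → closureOperator (Flip.isPartialOrder (⊆-isPartialOrder _)) r V-bip U-bip U⊆V x y

  module _ (U≢V : U ≢ V) where

    closure-case : ClosureOperator n _⊆_ U V →
      Contractible (△ (ProperPart n U V)) × möbius (Bip? n) U V ≡ 0ℤ
    closure-case γ =
      contractible (⊆-isPartialOrder _) _⊆?_ inj₁ inj₁ g (g U)
        (λ (W∈ , W≢U , W≢V) → g-∈ W∈ , g≢L W∈ , g≢G W∈ W≢V)
        (g-∈ U∈ , g≢L U∈ , g≢G U∈ U≢V)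
        (λ _ → ⊑-g) (λ _ _ → g-mono) (λ ((_ , U⊆W , _) , _) → g-mono U⊆W) ,
      möbius-closure (Bip? n) U g (V-bip , U⊆V , ⊆-refl) g-∈ ⊑-g g-mono g-idem g≢L g≢G
      where
      open ClosureOperator γ
      U∈ : Interval n U V U
      U∈ = U-bip , ⊆-refl , U⊆V

    -- Under reversed inclusion `⊑-g` reads `g W ⊆ W`, and the apex is `g V`. The recursion for
    -- `möbius` fixes the lower end of the interval, so this case uses `möbius-interior`.
    interior-case : ClosureOperator n (flip _⊆_) V U →
      Contractible (△ (ProperPart n U V)) × möbius (Bip? n) U V ≡ 0ℤ
    interior-case γ =
      contractible (Flip.isPartialOrder (⊆-isPartialOrder _)) (flip _⊆?_) inj₂ inj₂ g (g V)
        (λ (W∈ , W≢U , W≢V) → g-∈′ W∈ , g≢G (swap-∈ W∈) W≢U , g≢L (swap-∈ W∈))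
        (g-∈′ V∈ , g≢G (swap-∈ V∈) (U≢V ∘ sym) , g≢L (swap-∈ V∈))
        (λ _ → ⊑-g) (λ _ _ → g-mono) (λ ((_ , _ , W⊆V) , _) → g-mono W⊆V) ,
      möbius-interior (Bip? n) U g V∈ g-∈′ ⊑-g g-mono (λ W∈ → g≢G (swap-∈ W∈))
        (λ V⊆gV → g≢L (swap-∈ V∈) (⊆-antisym ⊑-g V⊆gV))
      where
      open ClosureOperator γ
      swap-∈ : ∀ {W} → Interval n U V W → Between n (flip _⊆_) V U W
      swap-∈ (W-bip , U⊆W , W⊆V) = W-bip , W⊆V , U⊆W
      g-∈′ : ∀ {W} → Interval n U V W → Interval n U V (g W)
      g-∈′ W∈ = let gW-bip , gW⊆V , U⊆gW = g-∈ (swap-∈ W∈) in gW-bip , U⊆gW , gW⊆V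
      V∈ : Interval n U V V
      V∈ = V-bip , U⊆V , ⊆-refl

theorem10p4 : (n : ℕ) (U V : Relation n) →
    Bip n U → Bip n V → U ⊆ V → ¬ Regular n U V →
    Contractible (△ (ProperPart n U V)) × möbius (Bip? n) U V ≡ 0ℤ
theorem10p4 n U V U-bip V-bip U⊆V ¬regular =
  let x , _ , w@((Vxx , ¬Uxx) , _) = irregular-pair n U-bip V-bip U⊆V ¬regular
      U≢V = λ U≡V → ¬Uxx (subst (λ W → Holds n W x x) (sym U≡V) Vxx)
  in [ closure-case n U-bip V-bip U⊆V U≢V , interior-case n U-bip V-bip U⊆V U≢V ]′
       (irregular⇒closureOperator n U-bip V-bip U⊆V w)
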